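{- Let $\mathcal{A}$ and $\mathcal{B}$ be the structures with three unary relations $U_1,U_2,U_3$ given by $A=\{1,2,3,4\}$, $U_1^{\mathcal{A}}=\{1\}$, $U_2^{\mathcal{A}}=\{2,3\}$, $U_3^{\mathcal{A}}=\{3,4\}$, and $B=\{1,2,3,4,5,6\}$, $U_1^{\mathcal{B}}=\{1,2,3\}$, $U_2^{\mathcal{B}}=\{3,4,5\}$, $U_3^{\mathcal{B}}=\{4,5,6\}$. Then $\mathrm{PMC}(\mathcal{A},\mathcal{B})$ is Pspace-complete.
   Context: A positive equality-free formula is a first-order formula built from relational atoms of the signature (the equality symbol is not available) using only $\forall,\exists,\wedge,\vee$. For structures $\mathcal{A},\mathcal{B}$ over the same signature such that every positive equality-free sentence true on $\mathcal{A}$ is true on $\mathcal{B}$, $\mathrm{PMC}(\mathcal{A},\mathcal{B})$ is the promise problem whose input is a positive equality-free sentence $\theta$, whose yes-instances are those with $\mathcal{A}\models\theta$ and whose no-instances are those with $\mathcal{B}\not\models\theta$ (any answer is allowed if $\mathcal{A}\not\models\theta$ and $\mathcal{B}\models\theta$). Such a promise problem is Pspace-complete if (membership) some polynomial-space algorithm answers correctly on all yes-instances and no-instances, and (hardness) for every language $L$ in Pspace there is a polynomial-time computable map sending members of $L$ to yes-instances and non-members of $L$ to no-instances. -}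

module Defs where

open import Data.Bool using (Bool; true; false)
open import Data.Fin using (Fin; zero; suc; toℕ)
open import Data.Fin.Properties using (toℕ-injective)
open import Data.List using (List; []; _∷_; _++_; _ʳ++_; length; map; replicate)
open import Data.List.Membership.Propositional using (_∈_)
open import Data.List.Properties using (++-assoc; ++-identityʳ; ∷-injectiveʳ)
open import Data.Maybe using (Maybe; just; nothing)
import Data.Maybe as Maybe
open import Data.Nat using (ℕ; zero; suc; _+_; _*_; _≤_)
open import Data.Product using (Σ; Σ-syntax; ∃-syntax; _×_; _,_; proj₁; proj₂)
open import Data.Sum using (_⊎_)
open import Data.Vec using (Vec; []; _∷_; lookup)
import Data.Vec as Vec
open import Function using (_∘_; id)
open import Function.Definitions using (Injective)
open import Relation.Binary.PropositionalEquality
  using (_≡_; refl; sym; trans; cong; cong₂)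
open import Relation.Nullary using (¬_)

record Signature : Set where
  field
    symbols : ℕ
    arity   : Fin symbols → ℕ

open Signature

record Structure (S : Signature) : Set₁ where
  field
    Carrier : Set
    rel     : (R : Fin (symbols S)) → Vec Carrier (arity S R) → Set

open Structure

-- Variables are de Bruijn indices: zero is bound by the innermost quantifier.
data Formula (S : Signature) (n : ℕ) : Set where
  atom      : (R : Fin (symbols S)) → Vec (Fin n) (arity S R) → Formula S n
  _∧′_ _∨′_ : Formula S n → Formula S n → Formula S n
  ∃′_ ∀′_   : Formula S (suc n) → Formula S n

Sentence : Signature → Set
Sentence S = Formula S 0

module _ {S : Signature} where

  Sat : ∀ {n} (A : Structure S) → Vec (Carrier A) n → Formula S n → Set
  Sat A ρ (atom R xs) = rel A R (Vec.map (lookup ρ) xs)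
  Sat A ρ (φ ∧′ ψ)    = Sat A ρ φ × Sat A ρ ψ
  Sat A ρ (φ ∨′ ψ)    = Sat A ρ φ ⊎ Sat A ρ ψ
  Sat A ρ (∃′ φ)      = Σ[ a ∈ Carrier A ] Sat A (a ∷ ρ) φ
  Sat A ρ (∀′ φ)      = (a : Carrier A) → Sat A (a ∷ ρ) φ

  infix 4 _⊨_ _⇛_

  _⊨_ : Structure S → Sentence S → Set
  A ⊨ θ = Sat A [] θ

  _⇛_ : Structure S → Structure S → Set
  A ⇛ B = ∀ θ → A ⊨ θ → B ⊨ θ

  -- Prefix notation.  Unary indices are harmless: the index of a variable is
  -- smaller than the number of quantifiers above it.
  unary : ℕ → List Bool
  unary zero    = false ∷ []
  unary (suc n) = true ∷ unary n

  encodeVars : ∀ {n k} → Vec (Fin n) k → List Bool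
  encodeVars []       = []
  encodeVars (x ∷ xs) = unary (toℕ x) ++ encodeVars xs

  encodeFormula : ∀ {n} → Formula S n → List Bool
  encodeFormula (atom R xs) = false ∷ (unary (toℕ R) ++ encodeVars xs)
  encodeFormula (φ ∧′ ψ)    = true ∷ false ∷ false ∷ (encodeFormula φ ++ encodeFormula ψ)
  encodeFormula (φ ∨′ ψ)    = true ∷ false ∷ true  ∷ (encodeFormula φ ++ encodeFormula ψ)
  encodeFormula (∃′ φ)      = true ∷ true  ∷ false ∷ encodeFormula φ
  encodeFormula (∀′ φ)      = true ∷ true  ∷ true  ∷ encodeFormula φ

  private
    drop3 : ∀ {a b c : Bool} {u v} → a ∷ b ∷ c ∷ u ≡ a ∷ b ∷ c ∷ v → u ≡ v
    drop3 = ∷-injectiveʳ ∘ ∷-injectiveʳ ∘ ∷-injectiveʳ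

    reassoc : ∀ (p q u p′ q′ v : List Bool) →
              (p ++ q) ++ u ≡ (p′ ++ q′) ++ v → p ++ (q ++ u) ≡ p′ ++ (q′ ++ v)
    reassoc p q u p′ q′ v e = trans (sym (++-assoc p q u)) (trans e (++-assoc p′ q′ v))

    unary-prefix : ∀ m n {u v} → unary m ++ u ≡ unary n ++ v → m ≡ n × u ≡ v
    unary-prefix zero    zero    refl = refl , refl
    unary-prefix zero    (suc n) ()
    unary-prefix (suc m) zero    ()
    unary-prefix (suc m) (suc n) e with unary-prefix m n (∷-injectiveʳ e)
    ... | refl , e′ = refl , e′

    vars-prefix : ∀ {n k} (xs ys : Vec (Fin n) k) {u v} →
                  encodeVars xs ++ u ≡ encodeVars ys ++ v → xs ≡ ys × u ≡ v
    vars-prefix []       []       e = refl , e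
    vars-prefix (x ∷ xs) (y ∷ ys) {u} {v} e
      with unary-prefix (toℕ x) (toℕ y)
             (reassoc (unary (toℕ x)) (encodeVars xs) u (unary (toℕ y)) (encodeVars ys) v e)
    ... | x≡y , e′ with vars-prefix xs ys e′
    ...   | xs≡ys , e″ = cong₂ _∷_ (toℕ-injective x≡y) xs≡ys , e″

    formula-prefix : ∀ {n} (φ ψ : Formula S n) {u v} →
                     encodeFormula φ ++ u ≡ encodeFormula ψ ++ v → φ ≡ ψ × u ≡ v
    pair-prefix : ∀ {n} (φ φ′ ψ ψ′ : Formula S n) {u v} →
                  (encodeFormula φ ++ encodeFormula φ′) ++ u ≡
                  (encodeFormula ψ ++ encodeFormula ψ′) ++ v →
                  φ ≡ ψ × φ′ ≡ ψ′ × u ≡ v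

    formula-prefix (atom R xs) (atom R′ ys) {u} {v} e
      with unary-prefix (toℕ R) (toℕ R′)
             (reassoc (unary (toℕ R)) (encodeVars xs) u (unary (toℕ R′)) (encodeVars ys) v
               (∷-injectiveʳ e))
    ... | R≡R′ , e′ with toℕ-injective R≡R′
    ...   | refl with vars-prefix xs ys e′
    ...     | refl , e″ = refl , e″
    formula-prefix (φ ∧′ φ′) (ψ ∧′ ψ′) e with pair-prefix φ φ′ ψ ψ′ (drop3 e)
    ... | refl , refl , e′ = refl , e′
    formula-prefix (φ ∨′ φ′) (ψ ∨′ ψ′) e with pair-prefix φ φ′ ψ ψ′ (drop3 e)
    ... | refl , refl , e′ = refl , e′
    formula-prefix (∃′ φ) (∃′ ψ) e with formula-prefix φ ψ (drop3 e)
    ... | refl , e′ = refl , e′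
    formula-prefix (∀′ φ) (∀′ ψ) e with formula-prefix φ ψ (drop3 e)
    ... | refl , e′ = refl , e′
    formula-prefix (atom _ _) (_ ∧′ _)   ()
    formula-prefix (atom _ _) (_ ∨′ _)   ()
    formula-prefix (atom _ _) (∃′ _)     ()
    formula-prefix (atom _ _) (∀′ _)     ()
    formula-prefix (_ ∧′ _)   (atom _ _) ()
    formula-prefix (_ ∧′ _)   (_ ∨′ _)   ()
    formula-prefix (_ ∧′ _)   (∃′ _)     ()
    formula-prefix (_ ∧′ _)   (∀′ _)     ()
    formula-prefix (_ ∨′ _)   (atom _ _) ()
    formula-prefix (_ ∨′ _)   (_ ∧′ _)   ()
    formula-prefix (_ ∨′ _)   (∃′ _)     ()
    formula-prefix (_ ∨′ _)   (∀′ _)     ()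
    formula-prefix (∃′ _)     (atom _ _) ()
    formula-prefix (∃′ _)     (_ ∧′ _)   ()
    formula-prefix (∃′ _)     (_ ∨′ _)   ()
    formula-prefix (∃′ _)     (∀′ _)     ()
    formula-prefix (∀′ _)     (atom _ _) ()
    formula-prefix (∀′ _)     (_ ∧′ _)   ()
    formula-prefix (∀′ _)     (_ ∨′ _)   ()
    formula-prefix (∀′ _)     (∃′ _)     ()

    pair-prefix φ φ′ ψ ψ′ {u} {v} e
      with formula-prefix φ ψ
             (reassoc (encodeFormula φ) (encodeFormula φ′) u
                      (encodeFormula ψ) (encodeFormula ψ′) v e)
    ... | φ≡ψ , e′ with formula-prefix φ′ ψ′ e′
    ...   | φ′≡ψ′ , e″ = φ≡ψ , φ′≡ψ′ , e″

  encodeFormula-injective : ∀ {n} → Injective _≡_ _≡_ (encodeFormula {n})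
  encodeFormula-injective {_} {φ} {ψ} e =
    proj₁ (formula-prefix φ ψ (cong (_++ []) e))

data Symbol (g : ℕ) : Set where
  blank : Symbol g
  bit   : Bool → Symbol g
  aux   : Fin g → Symbol g

data Move : Set where
  left stay right : Move

-- A two-way infinite tape, of which only the cells visited so far or carrying
-- the input are stored.  The list leftCells runs away from the head.
record Tape (g : ℕ) : Set where
  constructor tape
  field
    leftCells  : List (Symbol g)
    head       : Symbol g
    rightCells : List (Symbol g)

module _ {g : ℕ} where

  moveTape : Move → Tape g → Tape g
  moveTape left  (tape []       h rs)       = tape [] blank (h ∷ rs)
  moveTape left  (tape (l ∷ ls) h rs)       = tape ls l (h ∷ rs)
  moveTape stay  t                          = t
  moveTape right (tape ls       h [])       = tape (h ∷ ls) blank []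
  moveTape right (tape ls       h (r ∷ rs)) = tape (h ∷ ls) r rs

  write : Symbol g → Tape g → Tape g
  write a (tape ls _ rs) = tape ls a rs

  cells : Tape g → List (Symbol g)
  cells (tape ls h rs) = ls ʳ++ (h ∷ rs)

  initialTape : List Bool → Tape g
  initialTape []       = tape [] blank []
  initialTape (b ∷ bs) = tape [] (bit b) (map bit bs)

  Holds : Tape g → List Bool → Set
  Holds t w =
    ∃[ m ] ∃[ n ] cells t ≡ replicate m blank ++ map bit w ++ replicate n blank

-- Tape 0 carries the input, tape 1 the output (if any).
record Machine : Set where
  field
    states     : ℕ
    auxSymbols : ℕ
    workTapes  : ℕ

  tapes : ℕ
  tapes = 2 + workTapes

  State = Fin states
  Γ     = Symbol auxSymbols

  field
    start     : State
    accepting : State → Bool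
    -- The machine halts when no transition is given.
    δ         : State → Vec Γ tapes → Maybe (State × Vec (Γ × Move) tapes)

module _ (M : Machine) where
  open Machine M

  record Config : Set where
    constructor config
    field
      state    : State
      contents : Vec (Tape auxSymbols) tapes

  open Config

  initial : List Bool → Config
  initial x = config start (initialTape x ∷ Vec.replicate _ (initialTape []))

  act : Γ × Move → Tape auxSymbols → Tape auxSymbols
  act (a , m) t = moveTape m (write a t)

  step : Config → Maybe Config
  step (config q ts) =
    Maybe.map (λ (q′ , as) → config q′ (Vec.zipWith act as ts))
              (δ q (Vec.map Tape.head ts))

  data Steps : ℕ → Config → Config → Set where
    done : ∀ {c} → Steps 0 c c
    next : ∀ {t c d e} → step c ≡ just d → Steps t d e → Steps (suc t) c e

  record Halting (x : List Bool) : Set where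
    field
      time   : ℕ
      final  : Config
      run    : Steps time (initial x) final
      halted : step final ≡ nothing

    -- Stored cells are never discarded, so the final configuration accounts
    -- for every cell used during the run.
    space : ℕ
    space = Vec.sum (Vec.map (length ∘ cells) (contents final))

    answer : Bool
    answer = accepting (state final)

    outputTape : Tape auxSymbols
    outputTape = lookup (contents final) (suc zero)

Polynomial : Set
Polynomial = List ℕ

⟦_⟧ : Polynomial → ℕ → ℕ
⟦ []    ⟧ n = 0
⟦ c ∷ p ⟧ n = c + n * ⟦ p ⟧ n

record PromiseProblem : Set₁ where
  field
    Instance         : Set
    encode           : Instance → List Bool
    encode-injective : Injective _≡_ _≡_ encode
    Yes No           : Instance → Set
    disjoint         : ∀ i → Yes i → ¬ No i

Language : Set₁
Language = List Bool → Set

language : Language → PromiseProblem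
language L = record
  { Instance         = List Bool
  ; encode           = id
  ; encode-injective = id
  ; Yes              = L
  ; No               = λ x → ¬ L x
  ; disjoint         = λ _ l ¬l → ¬l l
  }

-- The machine must also halt, in polynomial space, on instances outside the
-- promise, where its answer is unconstrained.
InPSPACE : PromiseProblem → Set
InPSPACE P =
  Σ[ M ∈ Machine ] Σ[ p ∈ Polynomial ] ∀ (i : Instance) →
    Σ[ h ∈ Halting M (encode i) ]
      Halting.space h ≤ ⟦ p ⟧ (length (encode i)) ×
      (Yes i → Halting.answer h ≡ true) ×
      (No i → Halting.answer h ≡ false)
  where open PromiseProblem P

PolyTimeComputable : (List Bool → List Bool) → Set
PolyTimeComputable f =
  Σ[ M ∈ Machine ] Σ[ p ∈ Polynomial ] ∀ (x : List Bool) →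
    Σ[ h ∈ Halting M x ]
      Halting.time h ≤ ⟦ p ⟧ (length x) ×
      Holds (Halting.outputTape h) (f x)

ReducesTo : Language → PromiseProblem → Set
ReducesTo L P =
  Σ[ f ∈ (List Bool → Instance) ]
    PolyTimeComputable (encode ∘ f) ×
    (∀ x → L x → Yes (f x)) ×
    (∀ x → ¬ L x → No (f x))
  where open PromiseProblem P

PSPACE-hard : PromiseProblem → Set₁
PSPACE-hard P = (L : Language) → InPSPACE (language L) → ReducesTo L P

PSPACE-complete : PromiseProblem → Set₁
PSPACE-complete P = InPSPACE P × PSPACE-hard P

PMC : {S : Signature} (A B : Structure S) → A ⇛ B → PromiseProblem
PMC {S} A B A⇛B = record
  { Instance         = Sentence S
  ; encode           = encodeFormula
  ; encode-injective = encodeFormula-injective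
  ; Yes              = λ θ → A ⊨ θ
  ; No               = λ θ → ¬ (B ⊨ θ)
  ; disjoint         = λ θ A⊨θ B⊭θ → B⊭θ (A⇛B θ A⊨θ)
  }

threeUnary : Signature
threeUnary = record { symbols = 3 ; arity = λ _ → 1 }

-- The domain {1,…,n} is Fin n, with x : Fin n standing for suc (toℕ x).
unaryStructure : (n : ℕ) → (Fin 3 → List ℕ) → Structure threeUnary
unaryStructure n U = record
  { Carrier = Fin n
  ; rel     = λ { R (x ∷ []) → suc (toℕ x) ∈ U R }
  }

𝔸 : Structure threeUnary
𝔸 = unaryStructure 4 λ where
  zero             → 1 ∷ []
  (suc zero)       → 2 ∷ 3 ∷ []
  (suc (suc zero)) → 3 ∷ 4 ∷ []

𝔹 : Structure threeUnary
𝔹 = unaryStructure 6 λ where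
  zero             → 1 ∷ 2 ∷ 3 ∷ []
  (suc zero)       → 3 ∷ 4 ∷ 5 ∷ []
  (suc (suc zero)) → 4 ∷ 5 ∷ 6 ∷ []

{-# OPTIONS --safe #-}

-- Membership.  𝔸 ⊨ θ is decided by exhaustive evaluation; since 𝔸 ⇛ 𝔹, the
-- answer is also right on the sentences that fail in 𝔹.
--
-- Hardness.  Read a bit as U₁, its negation as U₃, and relativise ∀ to the
-- complement of U₂.  Then ∃ and ∀ behave as Boolean quantifiers both in 𝔸 and in
-- 𝔹, so quantified Boolean formulas can be used.  A machine working in space s is
-- a system of stacks of bits of height at most s, and Savitch's recursion
-- describes 2 ^ k of its steps by k nested copies of one piece of formula.
-- All constraints are stated while the bits they concern are being quantified
-- (or dummy variables are, in step with those bits), so that every de Bruijn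
-- index is an affine function of s alone.  The text of the formula is therefore
-- produced by nested loops over the input, without arithmetic.

module Submission where

open import Data.Bool using (Bool; true; false; _∧_; _∨_; if_then_else_; not)
import Data.Bool as Bool
open import Data.Fin using (Fin; zero; suc; toℕ; fromℕ<; combine; remQuot)
import Data.Fin as Fin
open import Data.Fin.Patterns
open import Data.Fin.Properties
  using (all?; any?; +↔⊎; *↔×; 2↔Bool; 1↔⊤; toℕ<n; toℕ-injective; toℕ-fromℕ<; toℕ-combine;
         remQuot-combine; finToFun-funToFin; pigeonhole)
open import Data.List
  using (List; []; _∷_; _++_; _ʳ++_; length; replicate; concatMap; reverse; foldr; foldl)
import Data.List as List
open import Data.List.Properties
  using (length-++; map-++; map-∘; ++-assoc; ++-identityʳ; ++-ʳ++; length-replicate; length-map;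
         length-ʳ++; ʳ++-defn; reverse-map; ʳ++-ʳ++; length-reverse; concatMap-++; reverse-foldr)
open import Data.Maybe using (Maybe; just; nothing; maybe′)
import Data.Maybe as Maybe
open import Data.Nat
  using (ℕ; zero; suc; _+_; _*_; _^_; _≤_; _<_; _<?_; _⊔_; z≤n; s≤s; z<s; s<s)
import Data.Nat as ℕ
open import Data.Nat.Properties hiding (_≟_)
open import Data.Nat.Solver using (module +-*-Solver)
open import Data.Product using (Σ-syntax; ∃-syntax; _×_; _,_; proj₁; proj₂; map; map₂; uncurry)
open import Data.Product.Function.NonDependent.Propositional using (_×-↔_)
open import Data.Sum using (_⊎_; inj₁; inj₂)
import Data.Sum as Sum
open import Data.Sum.Function.Propositional using (_⊎-↔_)
open import Data.Unit using (⊤; tt)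
open import Data.Vec using (Vec; []; _∷_; lookup; tabulate)
import Data.Vec as Vec
import Data.Vec.Properties as Vec
open import Function using (_↔_; _∘_; id; const; _∋_)
open import Function.Bundles using (module Inverse)
open import Function.Construct.Composition using (_↔-∘_)
open import Function.Construct.Identity using (↔-id)
open import Relation.Binary.PropositionalEquality
open import Relation.Nullary using (Dec; yes; no; does; ¬_; ¬?; contradiction)
open import Relation.Nullary.Decidable
  using (_×-dec_; _⊎-dec_; _→-dec_; from-yes; dec-true; dec-false)
open import Data.List.Membership.DecPropositional ℕ._≟_ using (_∈?_)
open import Defs
open Structure
open +-*-Solver using (solve; _:+_; _:*_; _:=_; con)

-- Hardness needs only two one-way transfers, from Boolean truth to `𝔸` and from `𝔹` to Boolean
-- truth, and this is why one formula serves both structures. In `𝔸` the sets U₁ and U₃ are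
-- inhabited and every element outside U₂ lies in one of them, so Boolean strategies can be played
-- there. In `𝔹` the sets U₁ and U₃ are complementary, so every witness has a definite bit, and both
-- kinds of element occur outside U₂, so the universal player can force either bit. Polynomial space
-- comes without a time bound. A halted machine is made to repeat its configuration for ever, so the
-- run is a deterministic sequence that becomes constant; counting configurations shows that it has
-- done so after 2 ^ (s · D) steps, D being the number of stacks. The formula can therefore speak of
-- exactly that many steps, and determinism turns its truth into an equivalence: the end block must
-- hold the one configuration reached from the start block.

private variable
  n : ℕ

-- Preservation of positive equality-free sentences

𝔸-rel? : (R : Fin 3) (a : Fin 4) → Dec (rel 𝔸 R (a ∷ []))
𝔸-rel? R a = _ ∈? _

-- A relation rather than a function, since no function maps four elements onto six. Totality
-- carries the witnesses of ∃ from `𝔸` to `𝔹`; surjectivity pulls the challenges of ∀ back from `𝔹`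
-- to `𝔸`.
_⊑_ : Fin 4 → Fin 6 → Set
a ⊑ b = ∀ R → rel 𝔸 R (a ∷ []) → rel 𝔹 R (b ∷ [])

_⊑?_ : ∀ a b → Dec (a ⊑ b)
a ⊑? b = all? λ R → 𝔸-rel? R a →-dec (_ ∈? _)

⊑-total : ∀ a → ∃[ b ] a ⊑ b
⊑-total = from-yes (all? λ a → any? λ b → a ⊑? b)

⊑-surjective : ∀ b → ∃[ a ] a ⊑ b
⊑-surjective = from-yes (all? λ b → any? λ a → a ⊑? b)

Sat-⊑ : ∀ (φ : Formula threeUnary n) {ρ σ} → (∀ i → lookup ρ i ⊑ lookup σ i) →
        Sat 𝔸 ρ φ → Sat 𝔹 σ φ
Sat-⊑ (atom R (x ∷ [])) ρ⊑σ s = ρ⊑σ x R s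
Sat-⊑ (φ ∧′ ψ) ρ⊑σ = map (Sat-⊑ φ ρ⊑σ) (Sat-⊑ ψ ρ⊑σ)
Sat-⊑ (φ ∨′ ψ) ρ⊑σ = Sum.map (Sat-⊑ φ ρ⊑σ) (Sat-⊑ ψ ρ⊑σ)
Sat-⊑ (∃′ φ) ρ⊑σ (a , s) with ⊑-total a
... | b , a⊑b = b , Sat-⊑ φ (λ { zero → a⊑b ; (suc i) → ρ⊑σ i }) s
Sat-⊑ (∀′ φ) ρ⊑σ s b with ⊑-surjective b
... | a , a⊑b = Sat-⊑ φ (λ { zero → a⊑b ; (suc i) → ρ⊑σ i }) (s a)

𝔸⇛𝔹 : 𝔸 ⇛ 𝔹
𝔸⇛𝔹 θ = Sat-⊑ θ λ ()

𝔸-sat? : (φ : Formula threeUnary n) (ρ : Vec (Fin 4) n) → Dec (Sat 𝔸 ρ φ)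
𝔸-sat? (atom R (x ∷ [])) ρ = 𝔸-rel? R (lookup ρ x)
𝔸-sat? (φ ∧′ ψ) ρ = 𝔸-sat? φ ρ ×-dec 𝔸-sat? ψ ρ
𝔸-sat? (φ ∨′ ψ) ρ = 𝔸-sat? φ ρ ⊎-dec 𝔸-sat? ψ ρ
𝔸-sat? (∃′ φ) ρ = any? λ a → 𝔸-sat? φ (a ∷ ρ)
𝔸-sat? (∀′ φ) ρ = all? λ a → 𝔸-sat? φ (a ∷ ρ)

-- Finite types of states and symbols, and runs of machines

record Finite (A : Set) : Set where
  constructor finite
  field
    {size}      : ℕ
    enumeration : Fin size ↔ A

  index : A → Fin size
  index = Inverse.from enumeration

  element : Fin size → A
  element = Inverse.to enumeration

  element-index : ∀ a → element (index a) ≡ a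
  element-index a = Inverse.inverseˡ enumeration refl

open Finite

Fin-finite : ∀ {n} → Finite (Fin n)
Fin-finite = finite (↔-id _)

⊤-finite : Finite ⊤
⊤-finite = finite 1↔⊤

Bool-finite : Finite Bool
Bool-finite = finite 2↔Bool

infixr 1 _⊎-finite_
infixr 2 _×-finite_

_⊎-finite_ : ∀ {A B} → Finite A → Finite B → Finite (A ⊎ B)
finite f ⊎-finite finite g = finite ((f ⊎-↔ g) ↔-∘ +↔⊎)

_×-finite_ : ∀ {A B} → Finite A → Finite B → Finite (A × B)
finite f ×-finite finite g = finite ((f ×-↔ g) ↔-∘ *↔×)

length-cells : ∀ {g} ls (h : Symbol g) rs → length (cells (tape ls h rs)) ≡ length ls + suc (length rs)
length-cells ls h rs = length-ʳ++ ls

module _ {M : Machine} where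

  Steps-trans : ∀ {t u c d e} → Steps M t c d → Steps M u d e → Steps M (t + u) c e
  Steps-trans done         s = s
  Steps-trans (next eq s) s′ = next eq (Steps-trans s s′)

-- A linear-space evaluator of sentences in `𝔸`

module Evaluator where

  State : Set
  State = Fin 5 ⊎ Fin 3 ⊎ Fin 3 ⊎ Bool ⊎ Bool ⊎ Bool

  State-finite : Finite State
  State-finite = Fin-finite ⊎-finite Fin-finite ⊎-finite Fin-finite
                 ⊎-finite Bool-finite ⊎-finite Bool-finite ⊎-finite Bool-finite

  pattern revive     = inj₁ 0F
  pattern rewind     = inj₁ 1F
  pattern eval       = inj₁ 2F
  pattern token      = inj₁ 3F
  pattern skip       = inj₁ 4F
  pattern relation R = inj₂ (inj₁ R)
  pattern variable′ R = inj₂ (inj₂ (inj₁ R))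
  pattern token₂ b   = inj₂ (inj₂ (inj₂ (inj₁ b)))
  pattern restore r  = inj₂ (inj₂ (inj₂ (inj₂ (inj₁ r))))
  pattern return r   = inj₂ (inj₂ (inj₂ (inj₂ (inj₂ r))))

  -- The input tape doubles as the recursion stack.  Digits of finished subformulas
  -- are dead; the last digit o of the token of a connective or quantifier under
  -- evaluation records how far it got: a connective waits for its left argument
  -- (pending) or remembers its value l (stored), a quantifier has accumulated the
  -- value a over the elements tried so far (looping).
  Mark : Set
  Mark = Bool ⊎ Bool ⊎ (Bool × Bool) ⊎ (Bool × Bool)

  Mark-finite : Finite Mark
  Mark-finite = Bool-finite ⊎-finite Bool-finite
                ⊎-finite (Bool-finite ×-finite Bool-finite)
                ⊎-finite (Bool-finite ×-finite Bool-finite)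

  data Cell : Set where
    empty : Cell
    fresh : Bool → Cell
    mark  : Mark → Cell

  pattern dead b      = mark (inj₁ b)
  pattern pending o   = mark (inj₂ (inj₁ o))
  pattern stored o l  = mark (inj₂ (inj₂ (inj₁ (o , l))))
  pattern looping o a = mark (inj₂ (inj₂ (inj₂ (o , a))))

  Γ : Set
  Γ = Symbol (size Mark-finite)

  symbol : Cell → Γ
  symbol empty     = blank
  symbol (fresh b) = bit b
  symbol (mark m)  = aux (index Mark-finite m)

  cell : Γ → Cell
  cell blank   = empty
  cell (bit b) = fresh b
  cell (aux i) = mark (element Mark-finite i)

  cell-symbol : ∀ c → cell (symbol c) ≡ c
  cell-symbol empty     = refl
  cell-symbol (fresh b) = refl
  cell-symbol (mark m)  = cong mark (element-index Mark-finite m)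

  -- The second tape is the stack of the values of the variables in scope.
  valueSymbol : Fin 4 → Γ
  valueSymbol 0F = blank
  valueSymbol 1F = bit false
  valueSymbol 2F = bit true
  valueSymbol 3F = aux zero

  value : Γ → Fin 4
  value blank       = 0F
  value (bit false) = 1F
  value (bit true)  = 2F
  value (aux _)     = 3F

  value-valueSymbol : ∀ v → value (valueSymbol v) ≡ v
  value-valueSymbol 0F = refl
  value-valueSymbol 1F = refl
  value-valueSymbol 2F = refl
  value-valueSymbol 3F = refl

  connect : Bool → Bool → Bool → Bool
  connect true  l r = l ∨ r
  connect false l r = l ∧ r

  -- The encoding marks ∨ by `true` but ∃ by `false`, hence the negation. It also makes `o` the
  -- neutral element of the resulting connective.
  accumulate : Bool → Bool → Bool → Bool
  accumulate o = connect (not o)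

  holds : Fin 3 → Fin 4 → Bool
  holds R v = does (𝔸-rel? R v)

  -- A quantifier starts with a = o, the neutral element of its connective.
  -- Between two rounds of its loop, everything to the right is revived, and the
  -- head rewinds to the nearest mark on the left.
  transition : State → Cell → Fin 4 → Maybe (State × (Cell × Move) × (Fin 4 × Move))
  transition revive          (fresh b)      v  = just (revive , (fresh b , right) , (v , stay))
  transition revive          (dead b)       v  = just (revive , (fresh b , right) , (v , stay))
  transition revive          empty          v  = just (rewind , (empty , left) , (v , stay))
  transition rewind          (fresh b)      v  = just (rewind , (fresh b , left) , (v , stay))
  transition rewind          empty          v  = just (eval , (empty , right) , (v , stay))
  transition rewind          (mark m)       v  = just (eval , (mark m , right) , (v , stay))
  transition eval            (fresh false)  v  = just (relation 0F , (dead false , right) , (v , stay))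
  transition eval            (fresh true)   v  = just (token , (dead true , right) , (v , stay))
  transition token           (fresh b)      v  = just (token₂ b , (dead b , right) , (v , stay))
  transition (token₂ false)  (fresh o)      v  = just (eval , (pending o , right) , (v , stay))
  transition (token₂ true)   (fresh o)      v  = just (eval , (looping o o , right) , (v , right))
  transition (relation R)    (fresh false)  v  = just (variable′ R , (dead false , right) , (v , stay))
  transition (relation 0F)   (fresh true)   v  = just (relation 1F , (dead true , right) , (v , stay))
  transition (relation 1F)   (fresh true)   v  = just (relation 2F , (dead true , right) , (v , stay))
  transition (variable′ R)   (fresh true)   v  = just (variable′ R , (dead true , right) , (v , left))
  transition (variable′ R)   (fresh false)  v  = just (restore (holds R v) , (dead false , left) , (v , stay))
  transition (restore r)     (dead true)    v  = just (restore r , (dead true , left) , (v , right))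
  transition (restore r)     (dead false)   v  = just (return r , (dead false , stay) , (v , stay))
  transition (return r)      (dead b)       v  = just (return r , (dead b , left) , (v , stay))
  transition (return r)      (pending o)    v  = just (skip , (stored o r , right) , (v , stay))
  transition (return r)      (stored o l)   v  = just (return (connect o l r) , (dead o , left) , (v , stay))
  transition (return r)      (looping o a)  0F = just (revive , (looping o (accumulate o a r) , right) , (1F , stay))
  transition (return r)      (looping o a)  1F = just (revive , (looping o (accumulate o a r) , right) , (2F , stay))
  transition (return r)      (looping o a)  2F = just (revive , (looping o (accumulate o a r) , right) , (3F , stay))
  transition (return r)      (looping o a)  3F = just (return (accumulate o a r) , (dead o , left) , (0F , left))
  transition skip            (dead b)       v  = just (skip , (dead b , right) , (v , stay))
  transition skip            (fresh b)      v  = just (eval , (fresh b , stay) , (v , stay))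
  transition _               _              _  = nothing

  encodeTransition : State × (Cell × Move) × (Fin 4 × Move) →
                     Fin (size State-finite) × Vec (Γ × Move) 2
  encodeTransition (s , (c , m) , (v , m′)) =
    index State-finite s , (symbol c , m) ∷ (valueSymbol v , m′) ∷ []

  isReturn : State → Bool
  isReturn (return r) = r
  isReturn _          = false

  machine : Machine
  machine = record
    { states     = size State-finite
    ; auxSymbols = size Mark-finite
    ; workTapes  = 0
    ; start      = index State-finite revive
    ; accepting  = isReturn ∘ element State-finite
    ; δ          = λ { q (a ∷ e ∷ []) →
        Maybe.map encodeTransition (transition (element State-finite q) (cell a) (value e)) }
    }

  record Zipper (A : Set) : Set where
    constructor zipper
    field
      before : List A
      focus  : A
      after  : List A

  record Situation : Set where
    constructor at
    field
      state : State
      input : Zipper Cell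
      stack : Zipper (Fin 4)

  open Zipper

  module _ {A : Set} (z : A) where

    focusʳ focusˡ : List A → List A → Zipper A
    focusʳ ls []       = zipper ls z []
    focusʳ ls (r ∷ rs) = zipper ls r rs
    focusˡ []       rs = zipper [] z rs
    focusˡ (l ∷ ls) rs = zipper ls l rs

    moveZipper : Move → Zipper A → Zipper A
    moveZipper left  (zipper ls h rs) = focusˡ ls (h ∷ rs)
    moveZipper stay  t                = t
    moveZipper right (zipper ls h rs) = focusʳ (h ∷ ls) rs

  toTape : ∀ {A} → (A → Γ) → Zipper A → Tape (size Mark-finite)
  toTape f (zipper ls h rs) = tape (List.map f ls) (f h) (List.map f rs)

  toTape-move : ∀ {A} (f : A → Γ) {z} → f z ≡ blank → ∀ m t →
                moveTape m (toTape f t) ≡ toTape f (moveZipper z m t)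
  toTape-move f eq left  (zipper []       h rs)       rewrite eq = refl
  toTape-move f eq left  (zipper (l ∷ ls) h rs)       = refl
  toTape-move f eq stay  t                            = refl
  toTape-move f eq right (zipper ls       h [])       rewrite eq = refl
  toTape-move f eq right (zipper ls       h (r ∷ rs)) = refl

  ⌜_⌝ : Situation → Config machine
  ⌜ at s t e ⌝ = config (index State-finite s) (toTape symbol t ∷ toTape valueSymbol e ∷ [])

  infix 4 _⟶_
  record _⟶_ (c d : Situation) : Set where
    constructor run
    field
      {time} : ℕ
      steps  : Steps machine time ⌜ c ⌝ ⌜ d ⌝

  infixr 5 _◅◅_
  _◅◅_ : ∀ {c d e} → c ⟶ d → d ⟶ e → c ⟶ e
  run s ◅◅ run s′ = run (Steps-trans s s′)

  ε : ∀ {c} → c ⟶ c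
  ε = run done

  ≡⇒⟶ : ∀ {c d} → c ≡ d → c ⟶ d
  ≡⇒⟶ refl = ε

  step-situation : ∀ s t e → step machine ⌜ at s t e ⌝ ≡
    Maybe.map (λ { (s′ , (c , m) , (v , m′)) →
        ⌜ at s′ (moveZipper empty m (zipper (before t) c (after t)))
                (moveZipper 0F m′ (zipper (before e) v (after e))) ⌝ })
      (transition s (focus t) (focus e))
  step-situation s t e
    rewrite element-index State-finite s | cell-symbol (focus t) | value-valueSymbol (focus e)
    with transition s (focus t) (focus e)
  ... | nothing = refl
  ... | just (_ , (_ , m) , (_ , m′)) =
    cong₂ (λ t′ e′ → just (config _ (t′ ∷ e′ ∷ [])))
      (toTape-move symbol refl m _) (toTape-move valueSymbol refl m′ _)

  step-⟶ : ∀ {s c v s′ c′ m v′ m′ ls rs ls′ rs′} →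
    transition s c v ≡ just (s′ , (c′ , m) , (v′ , m′)) →
    at s (zipper ls c rs) (zipper ls′ v rs′) ⟶
    at s′ (moveZipper empty m (zipper ls c′ rs)) (moveZipper 0F m′ (zipper ls′ v′ rs′))
  step-⟶ {s} {c} {v} eq = run (next (trans (step-situation s _ _) (cong (Maybe.map _) eq)) done)

  module _ {s : State} {f g : Bool → Cell} {e : Zipper (Fin 4)} where

    walk-right : (∀ b → transition s (f b) (focus e) ≡ just (s , (g b , right) , (focus e , stay))) →
      ∀ w {ls rs} → at s (focusʳ empty ls (List.map f w ++ rs)) e ⟶
                    at s (focusʳ empty (List.map g w ʳ++ ls) rs) e
    walk-right eq []      = ε
    walk-right eq (b ∷ w) = step-⟶ (eq b) ◅◅ walk-right eq w

    walk-left : (∀ b → transition s (f b) (focus e) ≡ just (s , (g b , left) , (focus e , stay))) →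
      ∀ w {ls rs} → at s (focusˡ empty (List.map f w ʳ++ ls) rs) e ⟶
                    at s (focusˡ empty ls (List.map g w ++ rs)) e
    walk-left eq []      = ε
    walk-left eq (b ∷ w) = walk-left eq w ◅◅ step-⟶ (eq b)

  rewind-walk : ∀ w {ls rs e} → at rewind (focusˡ empty (List.map fresh w ʳ++ ls) rs) e ⟶
                                at rewind (focusˡ empty ls (List.map fresh w ++ rs)) e
  rewind-walk w = walk-left (λ _ → refl) w

  return-walk : ∀ w {r ls rs e} → at (return r) (focusˡ empty (List.map dead w ʳ++ ls) rs) e ⟶
                                  at (return r) (focusˡ empty ls (List.map dead w ++ rs)) e
  return-walk w = walk-left (λ _ → refl) w

  top : ∀ {n} → Vec (Fin 4) n → Fin 4
  top []      = 0F
  top (v ∷ _) = v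

  below : ∀ {n} → Vec (Fin 4) n → List (Fin 4)
  below []      = []
  below (_ ∷ ρ) = top ρ ∷ below ρ

  stackOf : ∀ {n} → Vec (Fin 4) n → List (Fin 4) → Zipper (Fin 4)
  stackOf ρ es = zipper (below ρ) (top ρ) es

  -- Each `true` of the index costs one step down the value stack on the way right and one step up
  -- on the way back, so the stack ends with its head on the top again.
  lookup-run : ∀ k (ρ : Vec (Fin 4) n) x {ls rs es} →
    at (variable′ k) (focusʳ empty ls (List.map fresh (unary {threeUnary} (toℕ x)) ++ rs)) (stackOf ρ es) ⟶
    at (restore (holds k (lookup ρ x)))
       (focusˡ empty ls (List.map dead (unary {threeUnary} (toℕ x)) ++ rs)) (stackOf ρ es)
  lookup-run k (v ∷ ρ) zero    = step-⟶ refl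
  lookup-run k (v ∷ ρ) (suc x) = step-⟶ refl ◅◅ lookup-run k ρ x ◅◅ step-⟶ refl

  relation-run : ∀ k {ls rs e} →
    let w = false ∷ unary {threeUnary} (toℕ k) in
    at eval (focusʳ empty ls (List.map fresh w ++ rs)) e ⟶
    at (variable′ k) (focusʳ empty (List.map dead w ʳ++ ls) rs) e
  relation-run 0F = step-⟶ refl ◅◅ step-⟶ refl
  relation-run 1F = step-⟶ refl ◅◅ step-⟶ refl ◅◅ step-⟶ refl
  relation-run 2F = step-⟶ refl ◅◅ step-⟶ refl ◅◅ step-⟶ refl ◅◅ step-⟶ refl

  -- The `false` that ends the index of the relation symbol stops the walk back; otherwise digits of
  -- that index would be counted as digits of the variable.
  restore-run : ∀ (k : Fin 3) {r ls rs e} →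
    let t = focusˡ empty (List.map dead (false ∷ unary {threeUnary} (toℕ k)) ʳ++ ls) rs in
    at (restore r) t e ⟶ at (return r) t e
  restore-run 0F = step-⟶ refl
  restore-run 1F = step-⟶ refl
  restore-run 2F = step-⟶ refl

  -- The blank to the right of the input, stored because the opening sweep has stepped on it.
  exhausted : List Cell
  exhausted = empty ∷ []

  rest : List Bool → List Cell
  rest w = List.map fresh w ++ exhausted

  -- All marks inside `u` were turned into dead digits when `u` returned, so the mark nearest on the
  -- left is that of the looping quantifier itself.
  reset-run : ∀ u w {m L e} →
    at revive (focusʳ empty (mark m ∷ L) (List.map dead u ++ rest w)) e ⟶
    at eval (focusʳ empty (mark m ∷ L) (List.map fresh u ++ rest w)) e
  reset-run u w {m} {L} =
    walk-right (λ _ → refl) u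
    ◅◅ walk-right {f = fresh} (λ _ → refl) w
    ◅◅ step-⟶ refl
    ◅◅ walk-left (λ _ → refl) w
    ◅◅ walk-left (λ _ → refl) u
    ◅◅ step-⟶ refl

  -- The machine folds from the left, starting with the neutral element; `any?` and `all?` reduce to
  -- a fold from the right that ends in it.
  fold-loop : ∀ o a b c d → let _⊕_ = accumulate o in
              (((o ⊕ a) ⊕ b) ⊕ c) ⊕ d ≡ a ⊕ (b ⊕ (c ⊕ (d ⊕ o)))
  fold-loop false false false false false = refl
  fold-loop false false false false true  = refl
  fold-loop false false false true  d     = refl
  fold-loop false false true  c     d     = refl
  fold-loop false true  b     c     d     = refl
  fold-loop true  true  true  true  true  = refl
  fold-loop true  true  true  true  false = refl
  fold-loop true  true  true  false d     = refl
  fold-loop true  true  false c     d     = refl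
  fold-loop true  false b     c     d     = refl

  code : Formula threeUnary n → List Bool
  code = encodeFormula

  satisfied : Formula threeUnary n → Vec (Fin 4) n → Bool
  satisfied φ ρ = does (𝔸-sat? φ ρ)

  zeros : ℕ → List (Fin 4)
  zeros m = replicate m 0F

  map-++-++ : ∀ {A B : Set} (f : A → B) u v r →
              List.map f (u ++ v) ++ r ≡ List.map f u ++ List.map f v ++ r
  map-++-++ f u v r = trans (cong (_++ r) (map-++ f u v)) (++-assoc (List.map f u) _ _)

  -- The stack of values, with m popped cells above it, stays within B cells.
  EvaluatesTo : ℕ → Vec (Fin 4) n → List Bool → Bool → Set
  EvaluatesTo {n} B ρ u r = ∀ {L R} w {m} → R ≡ rest w → n + m ≤ B →
    ∃[ m′ ] n + m′ ≤ B ×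
      (at eval (focusʳ empty L (List.map fresh u ++ R)) (stackOf ρ (zeros m)) ⟶
       at (return r) (focusˡ empty L (List.map dead u ++ R)) (stackOf ρ (zeros m′)))

  -- Ensures that `skip` meets a fresh digit exactly where the right argument begins.
  nonempty : (φ : Formula threeUnary n) → ∃[ b ] ∃[ u ] code φ ≡ b ∷ u
  nonempty (atom _ _) = _ , _ , refl
  nonempty (_ ∧′ _)   = _ , _ , refl
  nonempty (_ ∨′ _)   = _ , _ , refl
  nonempty (∃′ _)     = _ , _ , refl
  nonempty (∀′ _)     = _ , _ , refl

  skip-run : ∀ (φ : Formula threeUnary n) {L R e} →
    at skip (focusʳ empty L (List.map fresh (code φ) ++ R)) e ⟶
    at eval (focusʳ empty L (List.map fresh (code φ) ++ R)) e
  skip-run φ with code φ | nonempty φ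
  ... | _ | _ , _ , refl = step-⟶ refl

  binary-run : ∀ o {B} (φ ψ : Formula threeUnary n) {ρ : Vec (Fin 4) n} {l r} →
    EvaluatesTo B ρ (code φ) l → EvaluatesTo B ρ (code ψ) r →
    EvaluatesTo B ρ (true ∷ false ∷ o ∷ code φ ++ code ψ) (connect o l r)
  binary-run o φ ψ {l = l} evalφ evalψ {L} {R} w R≡ n+m≤B
    rewrite map-++-++ fresh (code φ) (code ψ) R | map-++-++ dead (code φ) (code ψ) R
    -- While the left argument is being evaluated, the code of the right one is part of the
    -- untouched remainder of the input.
    with m₁ , n+m₁≤B , runφ ← evalφ {pending o ∷ dead false ∷ dead true ∷ L} (code ψ ++ w)
           (trans (cong (List.map fresh (code ψ) ++_) R≡) (sym (map-++-++ fresh (code ψ) w exhausted)))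
           n+m≤B
    with m₂ , n+m₂≤B , runψ ←
           evalψ {List.map dead (code φ) ʳ++ (stored o l ∷ dead false ∷ dead true ∷ L)} w R≡ n+m₁≤B
    = m₂ , n+m₂≤B ,
    (step-⟶ refl ◅◅ step-⟶ refl ◅◅ step-⟶ refl
     ◅◅ runφ ◅◅ step-⟶ refl
     ◅◅ walk-right (λ _ → refl) (code φ) ◅◅ skip-run ψ
     ◅◅ runψ ◅◅ return-walk (code φ) ◅◅ step-⟶ refl ◅◅ step-⟶ refl ◅◅ step-⟶ refl)

  -- Popping writes `0F`, whose symbol is the blank, so a reused cell and a brand-new one both hold
  -- the first value of the loop. Only the brand-new one costs space, which is the case that
  -- consumes the second bound.
  push : ∀ {B} m → n + m ≤ B → suc n ≤ B →
    ∃[ m′ ] suc n + m′ ≤ B × (∀ (ρ : Vec (Fin 4) n) →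
      focusʳ 0F (top ρ ∷ below ρ) (zeros m) ≡ stackOf (0F ∷ ρ) (zeros m′))
  push {n} {B} zero    _     n<B = 0 , subst (_≤ B) (cong suc (sym (+-identityʳ n))) n<B , λ _ → refl
  push {n} {B} (suc m) n+m≤B _   = m , subst (_≤ B) (+-suc n m) n+m≤B , λ _ → refl

  quantifier-run : ∀ o {B u} {ρ : Vec (Fin 4) n} {r : Fin 4 → Bool} → suc n ≤ B →
    (∀ v → EvaluatesTo B (v ∷ ρ) u (r v)) →
    let _⊕_ = accumulate o in
    EvaluatesTo B ρ (true ∷ true ∷ o ∷ u) (r 0F ⊕ (r 1F ⊕ (r 2F ⊕ (r 3F ⊕ o))))
  quantifier-run {n} o {B} {u} {ρ} {r} n<B evalu {L} {R} w {m} refl n+m≤B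
    using _⊕_ ← accumulate o
    using loop ← (λ a → looping o a ∷ dead true ∷ dead true ∷ L)
    with m′ , n+m′≤B , pushed ← push m n+m≤B n<B
    with m₀ , n+m₀≤B , run₀ ← evalu 0F {loop o} w refl n+m′≤B
    with m₁ , n+m₁≤B , run₁ ← evalu 1F {loop (o ⊕ r 0F)} w refl n+m₀≤B
    with m₂ , n+m₂≤B , run₂ ← evalu 2F {loop ((o ⊕ r 0F) ⊕ r 1F)} w refl n+m₁≤B
    with m₃ , n+m₃≤B , run₃ ← evalu 3F {loop (((o ⊕ r 0F) ⊕ r 1F) ⊕ r 2F)} w refl n+m₂≤B
    rewrite sym (fold-loop o (r 0F) (r 1F) (r 2F) (r 3F))
    -- The final pop leaves one more blank cell above the stack.
    = suc m₃ , subst (_≤ B) (sym (+-suc n m₃)) n+m₃≤B ,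
    (step-⟶ refl ◅◅ step-⟶ refl ◅◅ step-⟶ refl
     ◅◅ ≡⇒⟶ (cong (at eval _) (pushed ρ)) ◅◅ run₀
     ◅◅ step-⟶ refl ◅◅ reset-run u w ◅◅ run₁
     ◅◅ step-⟶ refl ◅◅ reset-run u w ◅◅ run₂
     ◅◅ step-⟶ refl ◅◅ reset-run u w ◅◅ run₃
     ◅◅ step-⟶ refl ◅◅ step-⟶ refl ◅◅ step-⟶ refl)

  split-bound : ∀ {n B} (u v : List Bool) → n + (3 + length (u ++ v)) ≤ B → n + length u ≤ B × n + length v ≤ B
  split-bound {n} u v b =
    ≤-trans (+-monoʳ-≤ n (≤-trans (m≤m+n _ _) u+v≤)) b ,
    ≤-trans (+-monoʳ-≤ n (≤-trans (m≤n+m _ _) u+v≤)) b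
    where
    u+v≤ : length u + length v ≤ 3 + length (u ++ v)
    u+v≤ = subst (_≤ 3 + length (u ++ v)) (length-++ u) (m≤n+m _ 3)

  body-bound : ∀ {n B} (u : List Bool) → n + (3 + length u) ≤ B → suc n + length u ≤ B
  body-bound {n} {B} u b = subst (_≤ B) (+-suc n _) (≤-trans (+-monoʳ-≤ n (s≤s (m≤n+m _ 2))) b)

  -- The bound survives the recursion because a quantifier adds one variable to the scope and
  -- removes three digits from the code.
  eval-run : ∀ (φ : Formula threeUnary n) ρ {B} → n + length (code φ) ≤ B →
             EvaluatesTo B ρ (code φ) (satisfied φ ρ)
  eval-run (atom k (x ∷ [])) ρ _ {L} {R} w {m} _ n+m≤B
    rewrite ++-identityʳ (unary {threeUnary} (toℕ x))
          | map-++-++ fresh (unary {threeUnary} (toℕ k)) (unary {threeUnary} (toℕ x)) R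
          | map-++-++ dead (unary {threeUnary} (toℕ k)) (unary {threeUnary} (toℕ x)) R
    = m , n+m≤B ,
    (relation-run k ◅◅ lookup-run k ρ x ◅◅ restore-run k
     ◅◅ return-walk (false ∷ unary {threeUnary} (toℕ k)))
  eval-run (φ ∧′ ψ) ρ b =
    let bφ , bψ = split-bound (code φ) (code ψ) b in
    binary-run false φ ψ (eval-run φ ρ bφ) (eval-run ψ ρ bψ)
  eval-run (φ ∨′ ψ) ρ b =
    let bφ , bψ = split-bound (code φ) (code ψ) b in
    binary-run true φ ψ (eval-run φ ρ bφ) (eval-run ψ ρ bψ)
  eval-run (∃′ φ) ρ b =
    let bφ = body-bound (code φ) b in
    quantifier-run false {u = code φ} (m+n≤o⇒m≤o _ bφ) (λ v → eval-run φ (v ∷ ρ) bφ)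
  eval-run (∀′ φ) ρ b =
    let bφ = body-bound (code φ) b in
    quantifier-run true {u = code φ} (m+n≤o⇒m≤o _ bφ) (λ v → eval-run φ (v ∷ ρ) bφ)

  ⌜initial⌝ : ∀ x → initial machine x ≡ ⌜ at revive (focusʳ empty [] (List.map fresh x)) (stackOf [] []) ⌝
  ⌜initial⌝ []      = refl
  ⌜initial⌝ (b ∷ x) = cong (λ t → config _ (tape [] (bit b) t ∷ _)) (map-∘ x)

  final : Sentence threeUnary → ℕ → Situation
  final θ m =
    at (return (satisfied θ [])) (zipper [] empty (List.map dead (code θ) ++ exhausted)) (stackOf [] (zeros m))

  -- Starting in `revive` stores the two blanks that surround the input: the right one lets later
  -- sweeps turn round, and on the left one the last return finds no transition and halts.
  decides : ∀ (θ : Sentence threeUnary) →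
    ∃[ m ] m ≤ length (code θ) ×
      (at revive (focusʳ empty [] (List.map fresh (code θ))) (stackOf [] []) ⟶
       final θ m)
  decides θ with m , m≤B , evaluation ← eval-run θ [] ≤-refl {exhausted} [] refl z≤n
    = m , m≤B ,
    (≡⇒⟶ (cong (λ u → at revive (focusʳ empty [] u) _) (sym (++-identityʳ _)))
     ◅◅ walk-right (λ _ → refl) (code θ)
     ◅◅ step-⟶ refl ◅◅ rewind-walk (code θ) {[]} ◅◅ step-⟶ refl ◅◅ evaluation)

  final-space : ∀ θ m →
    Vec.sum (Vec.map (length ∘ cells) (Config.contents ⌜ final θ m ⌝)) ≡ 2 + (length (code θ) + suc m)
  final-space θ m
    rewrite length-map symbol (List.map dead (code θ) ++ exhausted)
          | length-++ (List.map dead (code θ)) {exhausted}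
          | length-map (mark ∘ inj₁) (code θ)
          | length-map valueSymbol (zeros m) | length-replicate m {x = Fin 4 ∋ 0F}
          | +-identityʳ m | +-comm (length (code θ)) 1 = refl

  halting : ∀ (θ : Sentence threeUnary) → Σ[ h ∈ Halting machine (code θ) ]
    Halting.space h ≤ 3 + length (code θ) * 2 ×
    Halting.answer h ≡ satisfied θ []
  halting θ with m , m≤n , run {t} steps ← decides θ = record
    { time   = _
    ; final  = ⌜ final θ m ⌝
    ; run    = subst (λ c → Steps machine t c ⌜ final θ m ⌝) (sym (⌜initial⌝ (code θ))) steps
    ; halted = step-situation (return (satisfied θ [])) (Situation.input (final θ m)) (Situation.stack (final θ m))
    } , space≤ , cong isReturn (element-index State-finite (return (satisfied θ [])))
    where
    k = length (code θ)
    open ≤-Reasoning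
    space≤ : Vec.sum (Vec.map (length ∘ cells) (Config.contents ⌜ final θ m ⌝)) ≤ 3 + k * 2
    space≤ = begin
      Vec.sum (Vec.map (length ∘ cells) (Config.contents ⌜ final θ m ⌝)) ≡⟨ final-space θ m ⟩
      2 + (k + suc m) ≡⟨ cong (2 +_) (+-suc k m) ⟩
      3 + (k + m)     ≤⟨ +-monoʳ-≤ (3 + k) m≤n ⟩
      3 + (k + k)     ≡⟨ cong (λ j → 3 + (k + j)) (+-identityʳ k) ⟨
      3 + 2 * k       ≡⟨ cong (3 +_) (*-comm 2 k) ⟩
      3 + k * 2       ∎

𝔸-𝔹-PSPACE : InPSPACE (PMC 𝔸 𝔹 𝔸⇛𝔹)
𝔸-𝔹-PSPACE = Evaluator.machine , 3 ∷ 2 ∷ [] , λ θ →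
  let h , space≤ , answer≡ = Evaluator.halting θ
      k = length (encodeFormula θ) in
  h , subst (λ j → Halting.space h ≤ 3 + k * (2 + j)) (sym (*-zeroʳ k)) space≤ ,
  (λ yes → trans answer≡ (dec-true (𝔸-sat? θ []) yes)) ,
  (λ no → trans answer≡ (dec-false (𝔸-sat? θ []) (no ∘ 𝔸⇛𝔹 θ)))

-- Structured programs compiled to machines

module Programs where

  infixl 6 _+ᵖ_
  _+ᵖ_ : Polynomial → Polynomial → Polynomial
  []      +ᵖ q       = q
  (c ∷ p) +ᵖ []      = c ∷ p
  (c ∷ p) +ᵖ (d ∷ q) = c + d ∷ p +ᵖ q

  ⟦+ᵖ⟧ : ∀ p q n → ⟦ p +ᵖ q ⟧ n ≡ ⟦ p ⟧ n + ⟦ q ⟧ n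
  ⟦+ᵖ⟧ []      q       n = refl
  ⟦+ᵖ⟧ (c ∷ p) []      n = sym (+-identityʳ _)
  ⟦+ᵖ⟧ (c ∷ p) (d ∷ q) n
    rewrite ⟦+ᵖ⟧ p q n | *-distribˡ-+ n (⟦ p ⟧ n) (⟦ q ⟧ n) = +-interchange c d _ _
    where
    open import Algebra.Properties.CommutativeSemigroup +-commutativeSemigroup
      using () renaming (interchange to +-interchange)

  Γ₁ : Set
  Γ₁ = Symbol 1

  -- A left end marker.
  pattern ▷ = aux 0F

  Tapes : ℕ → Set
  Tapes = Vec (Tape 1)

  Actions : ℕ → Set
  Actions = Vec (Γ₁ × Move)

  heads : ∀ {k} → Tapes k → Vec Γ₁ k
  heads = Vec.map Tape.head

  apply : ∀ {k} → Actions k → Tapes k → Tapes k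
  apply = Vec.zipWith λ (a , m) t → moveTape m (write a t)

  idle : ∀ {k} → Vec Γ₁ k → Actions k
  idle = Vec.map (_, stay)

  apply-idle : ∀ {k} (ts : Tapes k) → apply (idle (heads ts)) ts ≡ ts
  apply-idle []       = refl
  apply-idle (t ∷ ts) = cong (t ∷_) (apply-idle ts)

  infixr 5 _⨾_

  data Program : ℕ → Set where
    perform  : ∀ {k} → (Vec Γ₁ k → Actions k) → Program k
    _⨾_    : ∀ {k} → Program k → Program k → Program k
    while  : ∀ {k} → (Vec Γ₁ k → Bool) → Program k → Program k
    branch : ∀ {k} → (Vec Γ₁ k → Bool) → Program k → Program k → Program k
    -- Leave the third tape alone.
    frame  : ∀ {k} → Program (2 + k) → Program (3 + k)

  private variable
    k t u : ℕ
    c d : Program k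

  -- The program counter. The extra `⊤` of `while` and of `branch` is the step spent on the test.
  Point : Program k → Set
  Point (perform _)    = ⊤
  Point (c ⨾ d)        = Point c ⊎ Point d
  Point (while _ c)    = ⊤ ⊎ Point c
  Point (branch _ c d) = ⊤ ⊎ Point c ⊎ Point d
  Point (frame c)      = Point c

  Point-finite : (c : Program k) → Finite (Point c)
  Point-finite (perform _)    = ⊤-finite
  Point-finite (c ⨾ d)        = Point-finite c ⊎-finite Point-finite d
  Point-finite (while _ c)    = ⊤-finite ⊎-finite Point-finite c
  Point-finite (branch _ c d) = ⊤-finite ⊎-finite Point-finite c ⊎-finite Point-finite d
  Point-finite (frame c)      = Point-finite c

  entry : (c : Program k) → Point c
  entry (perform _)    = tt
  entry (c ⨾ d)        = inj₁ (entry c)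
  entry (while _ _)    = inj₁ tt
  entry (branch _ _ _) = inj₁ tt
  entry (frame c)      = entry c

  frameActions : Γ₁ → Actions (2 + k) → Actions (3 + k)
  frameActions h (a ∷ b ∷ as) = a ∷ b ∷ (h , stay) ∷ as

  -- The point nothing stands for leaving the program.
  next-point : (c : Program k) → Point c → Vec Γ₁ k → Maybe (Point c)
  next-point (perform _)    _               hs = nothing
  next-point (c ⨾ d)        (inj₁ p)        hs = just (maybe′ inj₁ (inj₂ (entry d)) (next-point c p hs))
  next-point (c ⨾ d)        (inj₂ p)        hs = Maybe.map inj₂ (next-point d p hs)
  next-point (while b c)    (inj₁ _)        hs = if b hs then just (inj₂ (entry c)) else nothing
  next-point (while b c)    (inj₂ p)        hs = just (maybe′ inj₂ (inj₁ tt) (next-point c p hs))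
  next-point (branch b c d) (inj₁ _)        hs = just (inj₂ (if b hs then inj₁ (entry c) else inj₂ (entry d)))
  next-point (branch b c d) (inj₂ (inj₁ p)) hs = Maybe.map (inj₂ ∘ inj₁) (next-point c p hs)
  next-point (branch b c d) (inj₂ (inj₂ p)) hs = Maybe.map (inj₂ ∘ inj₂) (next-point d p hs)
  next-point (frame c)      p (i ∷ o ∷ _ ∷ hs) = next-point c p (i ∷ o ∷ hs)

  actions : (c : Program k) → Point c → Vec Γ₁ k → Actions k
  actions (perform f)    _               hs = f hs
  actions (c ⨾ d)        (inj₁ p)        hs = actions c p hs
  actions (c ⨾ d)        (inj₂ p)        hs = actions d p hs
  actions (while b c)    (inj₁ _)        hs = idle hs
  actions (while b c)    (inj₂ p)        hs = actions c p hs
  actions (branch b c d) (inj₁ _)        hs = idle hs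
  actions (branch b c d) (inj₂ (inj₁ p)) hs = actions c p hs
  actions (branch b c d) (inj₂ (inj₂ p)) hs = actions d p hs
  actions (frame c)      p (i ∷ o ∷ h ∷ hs) = frameActions h (actions c p (i ∷ o ∷ hs))

  after : (c : Program k) → Point c → Tapes k → Tapes k
  after c p ts = apply (actions c p (heads ts)) ts

  data Run (c : Program k) : ℕ → Point c → Tapes k → Tapes k → Set where
    exit : ∀ {p ts ts′} → next-point c p (heads ts) ≡ nothing → after c p ts ≡ ts′ → Run c 1 p ts ts′
    more : ∀ {p q ts ts′ ts″} → next-point c p (heads ts) ≡ just q → after c p ts ≡ ts′ →
           Run c t q ts′ ts″ → Run c (suc t) p ts ts″

  Exec : Program k → ℕ → Tapes k → Tapes k → Set
  Exec c t ts ts′ = Run c t (entry c) ts ts′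

  private variable
    ts ts′ ts″ : Tapes k
    b : Vec Γ₁ k → Bool

  exec-perform : ∀ {f : Vec Γ₁ k → Actions k} → apply (f (heads ts)) ts ≡ ts′ → Exec (perform f) 1 ts ts′
  exec-perform eq = exit refl eq

  exec-⨾ : Exec c t ts ts′ → Exec d u ts′ ts″ → Exec (c ⨾ d) (t + u) ts ts″
  exec-⨾ {c = c} {d = d} = first
    where
    second : ∀ {p t ts ts′} → Run d t p ts ts′ → Run (c ⨾ d) t (inj₂ p) ts ts′
    second (exit eq a)   = exit (cong (Maybe.map inj₂) eq) a
    second (more eq a r) = more (cong (Maybe.map inj₂) eq) a (second r)
    first : ∀ {p t u ts ts′ ts″} → Run c t p ts ts′ → Exec d u ts′ ts″ → Run (c ⨾ d) (t + u) (inj₁ p) ts ts″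
    first (exit eq a)   s = more (cong (just ∘ maybe′ inj₁ (inj₂ (entry d))) eq) a (second s)
    first (more eq a r) s = more (cong (just ∘ maybe′ inj₁ (inj₂ (entry d))) eq) a (first r s)

  exec-while-stop : b (heads ts) ≡ false → Exec (while b c) 1 ts ts
  exec-while-stop eq = exit (cong (if_then _ else _) eq) (apply-idle _)

  exec-while : b (heads ts) ≡ true → Exec c t ts ts′ → Exec (while b c) u ts′ ts″ →
               Exec (while b c) (suc (t + u)) ts ts″
  exec-while {b = b} {c = c} eq r s = more (cong (if_then _ else _) eq) (apply-idle _) (body r s)
    where
    body : ∀ {p t u ts ts′ ts″} → Run c t p ts ts′ → Exec (while b c) u ts′ ts″ →
           Run (while b c) (t + u) (inj₂ p) ts ts″
    body (exit eq a)   s = more (cong (just ∘ maybe′ inj₂ (inj₁ tt)) eq) a s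
    body (more eq a r) s = more (cong (just ∘ maybe′ inj₂ (inj₁ tt)) eq) a (body r s)

  exec-branch : ∀ r → b (heads ts) ≡ r → Exec (if r then c else d) t ts ts′ →
                Exec (branch b c d) (suc t) ts ts′
  exec-branch {b = b} {c = c} {d = d} true eq r =
    more (cong (λ r → just (inj₂ (if r then _ else _))) eq) (apply-idle _) (inside r)
    where
    inside : ∀ {p t ts ts′} → Run c t p ts ts′ → Run (branch b c d) t (inj₂ (inj₁ p)) ts ts′
    inside (exit eq a)   = exit (cong (Maybe.map (inj₂ ∘ inj₁)) eq) a
    inside (more eq a r) = more (cong (Maybe.map (inj₂ ∘ inj₁)) eq) a (inside r)
  exec-branch {b = b} {c = c} {d = d} false eq r =
    more (cong (λ r → just (inj₂ (if r then _ else _))) eq) (apply-idle _) (inside r)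
    where
    inside : ∀ {p t ts ts′} → Run d t p ts ts′ → Run (branch b c d) t (inj₂ (inj₂ p)) ts ts′
    inside (exit eq a)   = exit (cong (Maybe.map (inj₂ ∘ inj₂)) eq) a
    inside (more eq a r) = more (cong (Maybe.map (inj₂ ∘ inj₂)) eq) a (inside r)

  exec-frame : ∀ {c : Program (2 + k)} {s s′ r r′ ts ts′} x →
    Exec c t (s ∷ r ∷ ts) (s′ ∷ r′ ∷ ts′) → Exec (frame c) t (s ∷ r ∷ x ∷ ts) (s′ ∷ r′ ∷ x ∷ ts′)
  exec-frame {k} {c = c} x = inside
    where
    insert : Tapes (2 + k) → Tapes (3 + k)
    insert (s ∷ r ∷ ts) = s ∷ r ∷ x ∷ ts
    apply-frame : ∀ (as : Actions (2 + k)) {ts ts′} → apply as ts ≡ ts′ →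
                  apply (frameActions (Tape.head x) as) (insert ts) ≡ insert ts′
    apply-frame (_ ∷ _ ∷ _) {_ ∷ _ ∷ _} refl = refl
    inside : ∀ {p t ts ts′} → Run c t p ts ts′ → Run (frame c) t p (insert ts) (insert ts′)
    inside {p} {ts = ts@(_ ∷ _ ∷ _)} (exit eq a) = exit eq (apply-frame (actions c p (heads ts)) a)
    inside {p} {ts = ts@(_ ∷ _ ∷ _)} (more {ts′ = ts′@(_ ∷ _ ∷ _)} eq a r) =
      more eq (apply-frame (actions c p (heads ts)) a) (inside r)

  module _ (c : Program (2 + n)) where

    programMachine : Machine
    programMachine = record
      { states     = suc (size (Point-finite c))
      ; auxSymbols = 1
      ; workTapes  = n
      ; start      = suc (index (Point-finite c) (entry c))
      ; accepting  = λ _ → true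
      -- State `zero` means that the program has been left; program points are numbered from one.
      ; δ          = λ
        { zero    _  → nothing
        ; (suc q) hs → let p = element (Point-finite c) q in
                       just (maybe′ (suc ∘ index (Point-finite c)) zero (next-point c p hs) , actions c p hs) }
      }

    run-steps : ∀ {p} → Run c t p ts ts′ →
      Steps programMachine t (config (suc (index (Point-finite c) p)) ts) (config zero ts′)
    run-steps {p = p} (exit {ts = ts} eq refl) = next transition done
      where
      transition : step programMachine (config (suc (index (Point-finite c) p)) ts) ≡ just (config zero (after c p ts))
      transition rewrite element-index (Point-finite c) p | eq = refl
    run-steps {p = p} (more {q = q} {ts = ts} eq refl r) = next transition (run-steps r)
      where
      transition : step programMachine (config (suc (index (Point-finite c) p)) ts) ≡
                   just (config (suc (index (Point-finite c) q)) (after c p ts))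
      transition rewrite element-index (Point-finite c) p | eq = refl

-- Generating texts in polynomial time

module Texts where

  open Programs

  -- Strings produced by nested loops over the input, which is read backwards.
  data Text : Set where
    emit : List Bool → Text
    _⊕_  : Text → Text → Text
    for  : (Bool → Text) → Text

  generate : Text → List Bool → List Bool
  generate (emit u) x = u
  generate (e ⊕ e′) x = generate e x ++ generate e′ x
  generate (for f)  x = concatMap (λ b → generate (f b) x) (reverse x)

  depth : Text → ℕ
  depth (emit _) = 0
  depth (e ⊕ e′) = depth e ⊔ depth e′
  depth (for f)  = suc (depth (f true) ⊔ depth (f false))

  -- A loop spends 4 steps on its two single moves and the two failing tests, and 5 per bit: the
  -- loop test, the branch test and the move left, then a test and a move right while rewinding. The
  -- sum over the two bodies is a polynomial that bounds either of them.
  cost : Text → Polynomial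
  cost (emit u) = suc (length u) ∷ []
  cost (e ⊕ e′) = cost e +ᵖ cost e′
  cost (for f)  = 4 ∷ (5 ∷ []) +ᵖ (cost (f true) +ᵖ cost (f false))

  isBit isTrue : Γ₁ → Bool
  isBit (bit _) = true
  isBit _       = false
  isTrue (bit b) = b
  isTrue _       = false

  private variable
    k t u : ℕ
    c d : Program k
    ts ts′ : Tapes k

  onThird : ∀ {A : Set} → (Γ₁ → A) → Vec Γ₁ (3 + n) → A
  onThird f (_ ∷ _ ∷ h ∷ _) = f h

  moveThird : Move → Program (3 + n)
  moveThird m = perform λ { (i ∷ o ∷ h ∷ hs) → (i , stay) ∷ (o , stay) ∷ (h , m) ∷ idle hs }

  write-bits : List Bool → Program (2 + n)
  write-bits []      = perform idle
  write-bits (b ∷ u) = perform (λ { (i ∷ _ ∷ hs) → (i , stay) ∷ (bit b , right) ∷ idle hs }) ⨾ write-bits u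

  -- Each level of nesting has its own copy of the input, with the head at its right end.
  program : ∀ n → Text → Program (2 + n)
  program n       (emit u) = write-bits u
  program n       (e ⊕ e′) = program n e ⨾ program n e′
  program zero    (for f)  = perform idle
  program (suc n) (for f)  =
    moveThird left
    ⨾ while (onThird isBit)
        (branch (onThird isTrue) (frame (program n (f true))) (frame (program n (f false)))
         ⨾ moveThird left)
    ⨾ moveThird right
    ⨾ while (onThird isBit) (moveThird right)

  bits : List Bool → List Γ₁
  bits = List.map bit

  atEnd : List Γ₁ → Tape 1
  atEnd ls = tape ls blank []

  -- Both scans of a loop stop at a cell that is not a bit: the marker on the left, the blank on the
  -- right.
  copyOf : List Bool → Tape 1
  copyOf x = atEnd (bits x ʳ++ (▷ ∷ []))

  exec-write-bits : ∀ u {i ls} {ts : Tapes n} →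
    Exec (write-bits u) (suc (length u)) (i ∷ atEnd ls ∷ ts) (i ∷ atEnd (bits u ʳ++ ls) ∷ ts)
  exec-write-bits []      = exec-perform (cong (λ ts → _ ∷ _ ∷ ts) (apply-idle _))
  exec-write-bits (b ∷ u) =
    exec-⨾ (exec-perform (cong (λ ts → _ ∷ _ ∷ ts) (apply-idle _))) (exec-write-bits u)

  exec-moveThird : ∀ m {i o h} {ts : Tapes n} →
    Exec (moveThird m) 1 (i ∷ o ∷ h ∷ ts) (i ∷ o ∷ moveTape m h ∷ ts)
  exec-moveThird m = exec-perform (cong (λ ts → _ ∷ _ ∷ _ ∷ ts) (apply-idle _))

  exec-rewind : ∀ w {i o ls h} {ts : Tapes n} →
    Exec (while (onThird isBit) (moveThird right)) (suc (length w * 2))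
      (i ∷ o ∷ moveTape right (tape ls h (bits w ++ blank ∷ [])) ∷ ts)
      (i ∷ o ∷ atEnd (bits w ʳ++ (h ∷ ls)) ∷ ts)
  exec-rewind []      = exec-while-stop refl
  exec-rewind (b ∷ w) = exec-while refl (exec-moveThird right) (exec-rewind w)

  exec-from : ∀ {ts ts′ ts″ : Tapes k} → ts ≡ ts′ → Exec c t ts′ ts″ → Exec c t ts ts″
  exec-from refl run = run

  bits-++-ʳ++ : ∀ u v {ls} → bits (u ++ v) ʳ++ ls ≡ bits v ʳ++ (bits u ʳ++ ls)
  bits-++-ʳ++ u v = trans (cong (_ʳ++ _) (map-++ bit u v)) (++-ʳ++ (bits u))

  -- The work tapes come back as they were found, so the body of an enclosing loop can be run again.
  Writes : Program (2 + n) → Tapes n → ℕ → List Bool → Set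
  Writes c ts B u = ∀ {i ls} → ∃[ t ] t ≤ B ×
    Exec c t (i ∷ atEnd ls ∷ ts) (i ∷ atEnd (bits u ʳ++ ls) ∷ ts)

  exec-loop : ∀ {p q : Program (2 + n)} {ts B} {f : Bool → List Bool} →
    (∀ b → Writes (if b then p else q) ts B (f b)) →
    ∀ w {i ls h rs} → ∃[ t ] t ≤ suc (length w * (3 + B)) ×
      Exec (while (onThird isBit) (branch (onThird isTrue) (frame p) (frame q) ⨾ moveThird left)) t
        (i ∷ atEnd ls ∷ moveTape left (tape (bits w ++ ▷ ∷ []) h rs) ∷ ts)
        (i ∷ atEnd (bits (concatMap f w) ʳ++ ls) ∷ tape [] ▷ (bits w ʳ++ (h ∷ rs)) ∷ ts)
  exec-loop writes [] = 1 , ≤-refl , exec-while-stop refl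
  exec-loop {p = p} {q} {ts} {B} {f} writes (b ∷ w) {i} {ls} {h} {rs}
    with t , t≤B , body ← writes b {i} {ls}
    with u , u≤ , loop ← exec-loop {p = p} {q} {ts} writes w {i} {bits (f b) ʳ++ ls} {bit b} {h ∷ rs}
    rewrite bits-++-ʳ++ (f b) (concatMap f w) {ls}
    = suc (suc t + 1 + u) , s≤s time≤ ,
      exec-while refl (exec-⨾ (exec-branch b refl (framed b body)) (exec-moveThird left)) loop
    where
    time≤ : suc t + 1 + u ≤ 3 + B + length w * (3 + B)
    time≤ rewrite +-comm t 1 = ≤-trans (+-mono-≤ (+-monoʳ-≤ 2 t≤B) u≤) (≤-reflexive (+-suc (2 + B) _))
    framed : ∀ b {t s s′ r r′ x} → Exec (if b then p else q) t (s ∷ r ∷ ts) (s′ ∷ r′ ∷ ts) →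
             Exec (if b then frame p else frame q) t (s ∷ r ∷ x ∷ ts) (s′ ∷ r′ ∷ x ∷ ts)
    framed true  = exec-frame _
    framed false = exec-frame _

  module _ (x : List Bool) where

    copies : ∀ n → Tapes n
    copies n = Vec.replicate n (copyOf x)

    copyOf-forwards : bits x ʳ++ (▷ ∷ []) ≡ bits (reverse x) ++ ▷ ∷ []
    copyOf-forwards = trans (ʳ++-defn (bits x)) (cong (_++ _) (sym (reverse-map bit x)))

    bits-reverse-ʳ++ : ∀ {ls} → bits (reverse x) ʳ++ ls ≡ bits x ++ ls
    bits-reverse-ʳ++ = trans (cong (_ʳ++ _) (reverse-map bit x)) (ʳ++-ʳ++ (bits x))

    for-writes : ∀ {n B} f →
      (∀ b → Writes (if b then program n (f true) else program n (f false)) (copies n) B (generate (f b) x)) →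
      Writes (program (suc n) (for f)) (copies (suc n)) (4 + length x * (5 + B)) (generate (for f) x)
    for-writes {n} {B} f body {i} {ls}
      with t , t≤ , loop ← exec-loop {p = program n (f true)} {program n (f false)}
                           {f = λ b → generate (f b) x} body (reverse x) {i} {ls} {blank} {[]}
      = 1 + (t + (1 + suc (length x * 2))) , time≤ , exec-⨾ (exec-moveThird left)
          (exec-from (cong (λ l → i ∷ atEnd ls ∷ moveTape left (tape l blank []) ∷ copies n) copyOf-forwards)
          (exec-⨾ loop (exec-⨾ (exec-moveThird right)
            (exec-from
            (cong (λ r → i ∷ atEnd (bits (generate (for f) x) ʳ++ ls) ∷ moveTape right (tape [] ▷ r) ∷ copies n)
              bits-reverse-ʳ++)
            (exec-rewind x)))))
      where
      len = length x
      open ≤-Reasoning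
      time≤ : 1 + (t + (1 + suc (len * 2))) ≤ 4 + len * (5 + B)
      time≤ = begin
        1 + (t + (2 + len * 2))
          ≤⟨ s≤s (+-monoˡ-≤ _ t≤) ⟩
        1 + (suc (length (reverse x) * (3 + B)) + (2 + len * 2))
          ≡⟨ cong (λ l → 1 + (suc (l * (3 + B)) + (2 + len * 2))) (length-reverse x) ⟩
        1 + (suc (len * (3 + B)) + (2 + len * 2))
          ≡⟨ solve 2 (λ k B → con 1 :+ ((con 1 :+ (k :* (con 3 :+ B))) :+ (con 2 :+ k :* con 2))
                              := con 4 :+ k :* (con 5 :+ B)) refl len B ⟩
        4 + len * (5 + B) ∎

    program-writes : ∀ {n} e → depth e ≤ n → Writes (program n e) (copies n) (⟦ cost e ⟧ (length x)) (generate e x)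
    program-writes (emit u) _ =
      suc (length u) ,
      m≤m+n _ _ , exec-write-bits u
    program-writes (e ⊕ e′) d≤n {i} {ls}
      with t , t≤ , run ← program-writes e (m⊔n≤o⇒m≤o _ _ d≤n) {i} {ls}
      with u , u≤ , run′ ← program-writes e′ (m⊔n≤o⇒n≤o (depth e) _ d≤n) {i} {bits (generate e x) ʳ++ ls}
      rewrite bits-++-ʳ++ (generate e x) (generate e′ x) {ls} | ⟦+ᵖ⟧ (cost e) (cost e′) (length x)
      = t + u , +-mono-≤ t≤ u≤ , exec-⨾ run run′
    program-writes {suc n} (for f) (s≤s d≤n)
      rewrite ⟦+ᵖ⟧ (5 ∷ []) (cost (f true) +ᵖ cost (f false)) (length x)
            | *-zeroʳ (length x)
            | ⟦+ᵖ⟧ (cost (f true)) (cost (f false)) (length x)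
      = for-writes f λ where
        true  → weaken {u = generate (f true) x} (m≤m+n _ _) (program-writes (f true) (m⊔n≤o⇒m≤o _ _ d≤n))
        false → weaken {u = generate (f false) x} (m≤n+m _ _) (program-writes (f false) (m⊔n≤o⇒n≤o (depth (f true)) _ d≤n))
      where
      weaken : ∀ {B B′ c u} → B ≤ B′ → Writes c (copies n) B u → Writes c (copies n) B′ u
      weaken B≤ writes with t , t≤ , run ← writes = t , ≤-trans t≤ B≤ , run

  distribute copyAll : Program (2 + n)
  distribute =
    perform (λ { (i ∷ o ∷ hs) → (i , stay) ∷ (o , stay) ∷ Vec.replicate _ (▷ , right) })
    ⨾ while (isBit ∘ Vec.head) copyAll
  copyAll = perform λ { (i ∷ o ∷ hs) → (i , right) ∷ (o , stay) ∷ Vec.replicate _ (i , right) }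

  exec-distribute : ∀ x {o} → ∃[ i ]
    Exec (distribute {n}) (2 + length x * 2) (initialTape x ∷ o ∷ Vec.replicate n (initialTape [])) (i ∷ o ∷ copies x n)
  exec-distribute {n} x =
    proj₁ copying ,
    exec-⨾ (exec-perform (cong₂ (λ t ts → t ∷ _ ∷ ts) (start x) (Vec.zipWith-replicate _ _ _))) (proj₂ copying)
    where
    focus : List Γ₁ → List Bool → Tape 1
    focus ls []      = atEnd ls
    focus ls (b ∷ w) = tape ls (bit b) (bits w)
    start : ∀ x → initialTape x ≡ focus [] x
    start []      = refl
    start (_ ∷ _) = refl
    focus-right : ∀ ls b w → moveTape right (tape ls (bit b) (bits w)) ≡ focus (bit b ∷ ls) w
    focus-right ls b []      = refl
    focus-right ls b (_ ∷ _) = refl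
    copy : ∀ w {ls ks o} → ∃[ i ]
      Exec (while (isBit ∘ Vec.head) copyAll)
        (suc (length w * 2))
        (focus ls w ∷ o ∷ Vec.replicate n (atEnd ks)) (i ∷ o ∷ Vec.replicate n (atEnd (bits w ʳ++ ks)))
    copy []      = _ , exec-while-stop refl
    copy (b ∷ w) {ls} with i , copying ← copy w {bit b ∷ ls} =
      i , exec-while refl (exec-perform (cong₂ (λ t ts → t ∷ _ ∷ ts) (focus-right ls b w) (Vec.zipWith-replicate _ _ _))) copying
    copying : ∃[ i ] Exec _ _ _ _
    copying = copy x {[]} {▷ ∷ []}

  generate-polyTime : ∀ {f} e → (∀ x → generate e x ≡ f x) → PolyTimeComputable f
  generate-polyTime {f} e e≗f = programMachine whole , (2 ∷ 2 ∷ []) +ᵖ cost e , λ x →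
    let i , distributing  = exec-distribute x
        t , t≤ , writing = program-writes x e ≤-refl {i} {[]} in
    record
      { time   = 2 + length x * 2 + t
      ; final  = config zero (i ∷ atEnd (bits (generate e x) ʳ++ []) ∷ copies x (depth e))
      ; run    = run-steps whole (exec-⨾ distributing writing)
      ; halted = refl
      -- The single blank on the right is the cell scanned after the last digit was written.
      } , time≤ x t≤ , 0 , 1 , output x
    where
    whole : Program (2 + depth e)
    whole = distribute ⨾ program (depth e) e
    time≤ : ∀ x {t} → t ≤ ⟦ cost e ⟧ (length x) → 2 + length x * 2 + t ≤ ⟦ (2 ∷ 2 ∷ []) +ᵖ cost e ⟧ (length x)
    time≤ x {t} t≤ rewrite ⟦+ᵖ⟧ (2 ∷ 2 ∷ []) (cost e) (length x) | *-zeroʳ (length x) = +-monoʳ-≤ (2 + length x * 2) t≤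
    output : ∀ x → (bits (generate e x) ʳ++ []) ʳ++ (blank ∷ []) ≡ bits (f x) ++ blank ∷ []
    output x rewrite e≗f x = ʳ++-ʳ++ (bits (f x))

-- Quantified Boolean formulas inside `𝔸` and `𝔹`

module QuantifiedFormulas where

  open Texts

  data QF : Set where
    lit       : Bool → ℕ → QF
    _∧ᵠ_ _∨ᵠ_ : QF → QF → QF
    some all  : QF → QF

  Env : Set
  Env = ℕ → Bool

  infixr 5 _◂_
  _◂_ : Bool → Env → Env
  (b ◂ E) zero    = b
  (b ◂ E) (suc i) = E i

  True : Env → QF → Set
  True E (lit b i) = E i ≡ b
  True E (φ ∧ᵠ ψ)  = True E φ × True E ψ
  True E (φ ∨ᵠ ψ)  = True E φ ⊎ True E ψ
  True E (some φ)  = ∃[ b ] True (b ◂ E) φ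
  True E (all φ)   = ∀ b → True (b ◂ E) φ

  polarity : Bool → Fin 3
  polarity true  = 0F
  polarity false = 2F

  -- Indices out of scope denote the outermost variable.
  clamp : ∀ n → ℕ → Fin (suc n)
  clamp n       zero    = zero
  clamp zero    (suc i) = zero
  clamp (suc n) (suc i) = suc (clamp n i)

  -- In both structures, an element of U₁ \ U₃ plays true and one of U₃ \ U₁ plays
  -- false; universal variables are relativised to the complement of U₂, so that
  -- in 𝔸 the element 2, which lies in neither set, is not a choice.
  toFormula : ∀ n → QF → Formula threeUnary (suc n)
  toFormula n (lit b i) = atom (polarity b) (clamp n i ∷ [])
  toFormula n (φ ∧ᵠ ψ)  = toFormula n φ ∧′ toFormula n ψ
  toFormula n (φ ∨ᵠ ψ)  = toFormula n φ ∨′ toFormula n ψ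
  toFormula n (some φ)  = ∃′ toFormula (suc n) φ
  toFormula n (all φ)   = ∀′ (atom 1F (0F ∷ []) ∨′ toFormula (suc n) φ)

  𝔹-rel? : ∀ R b → Dec (rel 𝔹 R (b ∷ []))
  𝔹-rel? R b = _ ∈? _

  𝔸-choice : ∀ b → ∃[ a ] rel 𝔸 (polarity b) (a ∷ [])
  𝔸-choice true  = from-yes (any? λ a → 𝔸-rel? 0F a)
  𝔸-choice false = from-yes (any? λ a → 𝔸-rel? 2F a)

  𝔸-dichotomy : ∀ a → rel 𝔸 1F (a ∷ []) ⊎ rel 𝔸 0F (a ∷ []) ⊎ rel 𝔸 2F (a ∷ [])
  𝔸-dichotomy = from-yes (all? λ a → 𝔸-rel? 1F a ⊎-dec 𝔸-rel? 0F a ⊎-dec 𝔸-rel? 2F a)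

  True⇒𝔸 : ∀ φ {E} {ρ : Vec (Fin 4) (suc n)} →
           (∀ i → rel 𝔸 (polarity (E i)) (lookup ρ (clamp n i) ∷ [])) →
           True E φ → Sat 𝔸 ρ (toFormula n φ)
  True⇒𝔸 (lit b i) h refl       = h i
  True⇒𝔸 (φ ∧ᵠ ψ)  h            = map (True⇒𝔸 φ h) (True⇒𝔸 ψ h)
  True⇒𝔸 (φ ∨ᵠ ψ)  h            = Sum.map (True⇒𝔸 φ h) (True⇒𝔸 ψ h)
  True⇒𝔸 (some φ)  h (b , t) with a , r ← 𝔸-choice b =
    a , True⇒𝔸 φ (λ { zero → r ; (suc i) → h i }) t
  True⇒𝔸 (all φ)   h t a with 𝔸-dichotomy a
  ... | inj₁ r        = inj₁ r
  ... | inj₂ (inj₁ r) = inj₂ (True⇒𝔸 φ (λ { zero → r ; (suc i) → h i }) (t true))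
  ... | inj₂ (inj₂ r) = inj₂ (True⇒𝔸 φ (λ { zero → r ; (suc i) → h i }) (t false))

  -- Testing U₁ alone suffices, because U₃ is its complement in `𝔹`. Elements of U₂ get a bit as
  -- well, so any existential witness can be read.
  𝔹-value : Fin 6 → Bool
  𝔹-value a = does (𝔹-rel? 0F a)

  𝔹-value-correct : ∀ a b → rel 𝔹 (polarity b) (a ∷ []) → 𝔹-value a ≡ b
  𝔹-value-correct a true  = from-yes (all? λ a → 𝔹-rel? 0F a →-dec (𝔹-value a Bool.≟ true)) a
  𝔹-value-correct a false = from-yes (all? λ a → 𝔹-rel? 2F a →-dec (𝔹-value a Bool.≟ false)) a

  -- Against such an element the escape through the disjunct U₂ is closed, so the universal player
  -- can impose the bit `b`.
  𝔹-challenge : ∀ b → ∃[ a ] ¬ rel 𝔹 1F (a ∷ []) × 𝔹-value a ≡ b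
  𝔹-challenge true  = from-yes (any? λ a → ¬? (𝔹-rel? 1F a) ×-dec (𝔹-value a Bool.≟ true))
  𝔹-challenge false = from-yes (any? λ a → ¬? (𝔹-rel? 1F a) ×-dec (𝔹-value a Bool.≟ false))

  𝔹⇒True : ∀ φ {E} {ρ : Vec (Fin 6) (suc n)} →
           (∀ i → 𝔹-value (lookup ρ (clamp n i)) ≡ E i) →
           Sat 𝔹 ρ (toFormula n φ) → True E φ
  𝔹⇒True (lit b i) h s             = trans (sym (h i)) (𝔹-value-correct _ b s)
  𝔹⇒True (φ ∧ᵠ ψ)  h               = map (𝔹⇒True φ h) (𝔹⇒True ψ h)
  𝔹⇒True (φ ∨ᵠ ψ)  h               = Sum.map (𝔹⇒True φ h) (𝔹⇒True ψ h)
  𝔹⇒True (some φ)  h (a , s)       = 𝔹-value a , 𝔹⇒True φ (λ { zero → refl ; (suc i) → h i }) s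
  𝔹⇒True (all φ)   h s b with 𝔹-challenge b
  ... | a , ¬r , eq with s a
  ...   | inj₁ r  = contradiction r ¬r
  ...   | inj₂ s′ = 𝔹⇒True φ (λ { zero → eq ; (suc i) → h i }) s′

  digits : ℕ → List Bool
  digits = unary {threeUnary}

  code : QF → List Bool
  code (lit b i) = false ∷ (digits (toℕ (polarity b)) ++ digits i)
  code (φ ∧ᵠ ψ)  = true ∷ false ∷ false ∷ (code φ ++ code ψ)
  code (φ ∨ᵠ ψ)  = true ∷ false ∷ true ∷ (code φ ++ code ψ)
  code (some φ)  = true ∷ true ∷ false ∷ code φ
  -- Three digits for ∀, three for ∨, and four for the atom that puts the variable just bound into
  -- U₂.
  code (all φ)   = true ∷ true ∷ true ∷ true ∷ false ∷ true ∷ false ∷ true ∷ false ∷ false ∷ code φ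

  toℕ-clamp : ∀ {n i} → i ≤ n → toℕ (clamp n i) ≡ i
  toℕ-clamp {n}     {zero}  _         = refl
  toℕ-clamp {suc n} {suc i} (s≤s i≤n) = cong suc (toℕ-clamp i≤n)

  length-digits : ∀ i → length (digits i) ≡ suc i
  length-digits zero    = refl
  length-digits (suc i) = cong suc (length-digits i)

  index≤length : ∀ b i → i ≤ length (code (lit b i))
  index≤length b i rewrite length-++ (digits (toℕ (polarity b))) {digits i} | length-digits i =
    m≤n⇒m≤1+n (≤-trans (n≤1+n i) (m≤n+m (suc i) _))

  length-left : ∀ (u : List Bool) {v} → length u ≤ 3 + length (u ++ v)
  length-left u = m≤n⇒m≤o+n 3 (subst (length u ≤_) (sym (length-++ u)) (m≤m+n _ _))

  length-right : ∀ (u : List Bool) {v} → length v ≤ 3 + length (u ++ v)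
  length-right u = m≤n⇒m≤o+n 3 (subst (_ ≤_) (sym (length-++ u)) (m≤n+m _ _))

  -- An index is shorter than its unary code, hence at most the length of the whole code; with that
  -- many variables in scope nothing is clamped.
  encode-toFormula : ∀ φ {n} → length (code φ) ≤ n → encodeFormula (toFormula n φ) ≡ code φ
  encode-toFormula (lit b i) {n} len≤n
    rewrite ++-identityʳ (digits (toℕ (clamp n i))) | toℕ-clamp {n} {i} (≤-trans (index≤length b i) len≤n) = refl
  encode-toFormula (φ ∧ᵠ ψ) len≤n = cong₂ (λ u v → true ∷ false ∷ false ∷ (u ++ v))
    (encode-toFormula φ (≤-trans (length-left (code φ)) len≤n)) (encode-toFormula ψ (≤-trans (length-right (code φ)) len≤n))
  encode-toFormula (φ ∨ᵠ ψ) len≤n = cong₂ (λ u v → true ∷ false ∷ true ∷ (u ++ v))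
    (encode-toFormula φ (≤-trans (length-left (code φ)) len≤n)) (encode-toFormula ψ (≤-trans (length-right (code φ)) len≤n))
  encode-toFormula (some φ) len≤n =
    cong (λ u → true ∷ true ∷ false ∷ u) (encode-toFormula φ (m≤n⇒m≤1+n (≤-trans (m≤n+m _ 3) len≤n)))
  encode-toFormula (all φ) len≤n =
    cong (λ u → true ∷ true ∷ true ∷ true ∷ false ∷ true ∷ false ∷ true ∷ false ∷ false ∷ u)
      (encode-toFormula φ (m≤n⇒m≤1+n (≤-trans (m≤n+m _ 10) len≤n)))

  -- Only the length of the list matters. Taking a list lets the code of the formula itself supply
  -- the number of dummy quantifiers.
  close : (u : List Bool) → Formula threeUnary (suc (length u)) → Sentence threeUnary
  close []      φ = ∃′ φ
  close (_ ∷ u) φ = close u (∃′ φ)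

  ∃-code : List Bool
  ∃-code = true ∷ true ∷ false ∷ []

  encode-close : ∀ u φ → encodeFormula (close u φ) ≡ ∃-code ++ concatMap (const ∃-code) u ++ encodeFormula φ
  encode-close []      φ = refl
  encode-close (_ ∷ u) φ = trans (encode-close u (∃′ φ)) (cong (∃-code ++_) (commute u))
    where
    commute : ∀ (u : List Bool) {v} → concatMap (const ∃-code) u ++ ∃-code ++ v ≡ ∃-code ++ concatMap (const ∃-code) u ++ v
    commute []      = refl
    commute (_ ∷ u) = cong (∃-code ++_) (commute u)

  close-intro : ∀ {A : Structure threeUnary} u {φ} {ρ : Vec (Carrier A) (suc (length u))} → Sat A ρ φ → A ⊨ close u φ
  close-intro []      {ρ = a ∷ []} s = a , s
  close-intro (_ ∷ u) {ρ = a ∷ ρ} s = close-intro u (a , s)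

  close-elim : ∀ {A : Structure threeUnary} u {φ} → A ⊨ close u φ → ∃[ ρ ] Sat A ρ φ
  close-elim []      (a , s) = a ∷ [] , s
  close-elim (_ ∷ u) s with ρ , a , s′ ← close-elim u s = a ∷ ρ , s′

  -- A formula has fewer free variables than its code has digits, so as many dummy quantifiers close it.
  sentence : QF → Sentence threeUnary
  sentence φ = close (code φ) (toFormula (length (code φ)) φ)

  sentence-𝔸 : ∀ φ → (∀ E → True E φ) → 𝔸 ⊨ sentence φ
  sentence-𝔸 φ t = close-intro (code φ) {ρ = ρ} (True⇒𝔸 φ {λ _ → true} constant (t _))
    where
    ρ = Vec.replicate (suc (length (code φ))) (proj₁ (𝔸-choice true))
    constant : ∀ i → rel 𝔸 0F (lookup ρ (clamp _ i) ∷ [])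
    constant i = subst (λ a → rel 𝔸 0F (a ∷ [])) (sym (Vec.lookup-replicate (clamp _ i) _)) (proj₂ (𝔸-choice true))

  sentence-𝔹 : ∀ φ → 𝔹 ⊨ sentence φ → ∃[ E ] True E φ
  sentence-𝔹 φ s with ρ , s′ ← close-elim (code φ) s =
    (λ i → 𝔹-value (lookup ρ (clamp _ i))) , 𝔹⇒True φ (λ _ → refl) s′

  -- Running the same loops with each digit replaced by a quantifier produces the right number of
  -- dummies without any counter.
  dummies : Text → Text
  dummies (emit u) = emit (concatMap (const ∃-code) u)
  dummies (e ⊕ e′) = dummies e ⊕ dummies e′
  dummies (for f)  = for (dummies ∘ f)

  generate-dummies : ∀ e x → generate (dummies e) x ≡ concatMap (const ∃-code) (generate e x)
  generate-dummies (emit u) x = refl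
  generate-dummies (e ⊕ e′) x = trans (cong₂ _++_ (generate-dummies e x) (generate-dummies e′ x))
    (sym (concatMap-++ (const ∃-code) (generate e x) _))
  generate-dummies (for f) x = loop (reverse x)
    where
    loop : ∀ w → concatMap (λ b → generate (dummies (f b)) x) w ≡
           concatMap (const ∃-code) (concatMap (λ b → generate (f b) x) w)
    loop []      = refl
    loop (b ∷ w) = trans (cong₂ _++_ (generate-dummies (f b) x) (loop w))
      (sym (concatMap-++ (const ∃-code) (generate (f b) x) _))

  -- The dummy variables provide an environment that nothing controls, so members must give truth in
  -- every environment and non-members truth in none.
  reduction : ∀ {L : Language} (φ : List Bool → QF) e → (∀ x → generate e x ≡ code (φ x)) →
    (∀ x → L x → ∀ E → True E (φ x)) → (∀ x → ¬ L x → ∀ E → ¬ True E (φ x)) →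
    ReducesTo L (PMC 𝔸 𝔹 𝔸⇛𝔹)
  reduction φ e e≗φ complete sound =
    sentence ∘ φ ,
    generate-polyTime (emit ∃-code ⊕ (dummies e ⊕ e)) text ,
    (λ x l → sentence-𝔸 (φ x) (complete x l)) ,
    (λ x ¬l s → let E , t = sentence-𝔹 (φ x) s in sound x ¬l E t)
    where
    text : ∀ x → ∃-code ++ generate (dummies e) x ++ generate e x ≡ encodeFormula (sentence (φ x))
    text x = sym (trans (encode-close (code (φ x)) (toFormula _ (φ x))) (cong (∃-code ++_) (sym (cong₂ _++_
      (trans (generate-dummies e x) (cong (concatMap (const ∃-code)) (e≗φ x)))
      (trans (e≗φ x) (sym (encode-toFormula (φ x) ≤-refl)))))))

-- Templates for formulas of polynomial size

module FormulaTemplates where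

  open Texts
  open QuantifiedFormulas

  iter : ∀ {A : Set} → ℕ → (A → A) → A → A
  iter zero    f a = a
  iter (suc n) f a = f (iter n f a)

  iter-+ : ∀ {A : Set} m n {f : A → A} {a} → iter (m + n) f a ≡ iter m f (iter n f a)
  iter-+ zero    n {f} = refl
  iter-+ (suc m) n {f} = cong f (iter-+ m n)

  iter-* : ∀ {A : Set} m n {f : A → A} {a} → iter (m * n) f a ≡ iter m (iter n f) a
  iter-* zero    n         = refl
  iter-* (suc m) n {f} {a} = trans (iter-+ n (m * n)) (cong (iter n f) (iter-* m n))

  iter-suc : ∀ {A : Set} n {f : A → A} {a} → iter n f (f a) ≡ f (iter n f a)
  iter-suc zero        = refl
  iter-suc (suc n) {f} = cong f (iter-suc n)

  iter-cong : ∀ {A : Set} n {f g : A → A} {a} → f ≗ g → iter n f a ≡ iter n g a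
  iter-cong zero    eq = refl
  iter-cong (suc n) {f} {g} eq = trans (cong f (iter-cong n eq)) (eq (iter n g _))

  -- Templates of formulas in which everything is repeated a number of times
  -- polynomial in the length of the input; the index (α , β) stands for α · s + β.
  module Templates (p : Polynomial) where

    Index : Set
    Index = ℕ × ℕ

    infixr 7 _⨟_
    infixr 6 _◃_

    data Context : Set
    data Template : Set

    -- Contexts have their hole in last position, so in prefix notation the text of a context is a
    -- prefix and plugging is concatenation.
    data Context where
      some all     : Context
      assert       : Template → Context
      skip         : Context
      _⨟_          : Context → Context → Context
      iterᵖ        : Context → Context
      forInput     : (Bool → Context) → Context

    data Template where
      lit     : Bool → Index → Template
      _∧ᵗ_ _∨ᵗ_ : Template → Template → Template
      _◃_     : Context → Template → Template

    times : ℕ → Context → Context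
    times zero    C = skip
    times (suc n) C = C ⨟ times n C

    iterˢ : Context → Context
    iterˢ C = forInput (const C) ⨟ iterᵖ C

    repeat : ℕ → Text → Text
    repeat zero    e = emit []
    repeat (suc n) e = e ⊕ repeat n e

    -- Horner's rule, following the recursion of the evaluation of polynomials.
    power : Polynomial → Text → Text
    power []      e = emit []
    power (c ∷ q) e = repeat c e ⊕ for (const (power q e))

    contextText  : Context → Text
    templateText : Template → Text

    contextText some         = emit (true ∷ true ∷ false ∷ [])
    contextText all          = emit (true ∷ true ∷ true ∷ true ∷ false ∷ true ∷ false ∷ true ∷ false ∷ false ∷ [])
    contextText (assert T)   = emit (true ∷ false ∷ false ∷ []) ⊕ templateText T
    contextText skip         = emit []
    contextText (C ⨟ D)      = contextText C ⊕ contextText D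
    contextText (iterᵖ C)    = power p (contextText C)
    contextText (forInput f) = for (contextText ∘ f)

    templateText (lit b (α , β)) =
      emit (false ∷ digits (toℕ (polarity b)))
      -- In unary notation, α · s + β is s groups of α ones followed by the digits of β.
      ⊕ ((for (const 1^α) ⊕ power p 1^α) ⊕ emit (digits β))
      where 1^α = emit (replicate α true)
    templateText (T ∧ᵗ U) = emit (true ∷ false ∷ false ∷ []) ⊕ (templateText T ⊕ templateText U)
    templateText (T ∨ᵗ U) = emit (true ∷ false ∷ true ∷ []) ⊕ (templateText T ⊕ templateText U)
    templateText (C ◃ T)  = contextText C ⊕ templateText T

    module _ (x : List Bool) where

      -- The length of the input is added so that s repetitions split into a loop over the input and
      -- a loop of length given by `p`, the shape that loading the input has as well.
      s : ℕ
      s = length x + ⟦ p ⟧ (length x)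

      ⟪_⟫ : Index → ℕ
      ⟪ α , β ⟫ = α * s + β

      plug : Context → QF → QF
      instantiate : Template → QF

      plug some         φ = some φ
      plug all          φ = all φ
      plug (assert T)   φ = instantiate T ∧ᵠ φ
      plug skip         φ = φ
      plug (C ⨟ D)      φ = plug C (plug D φ)
      plug (iterᵖ C)    φ = iter (⟦ p ⟧ (length x)) (plug C) φ
      plug (forInput f) φ = foldr (λ b → plug (f b)) φ (reverse x)

      instantiate (lit b i) = lit b ⟪ i ⟫
      instantiate (T ∧ᵗ U)  = instantiate T ∧ᵠ instantiate U
      instantiate (T ∨ᵗ U)  = instantiate T ∨ᵠ instantiate U
      instantiate (C ◃ T)   = plug C (instantiate T)

      plug-times : ∀ n {C φ} → plug (times n C) φ ≡ iter n (plug C) φ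
      plug-times zero            = refl
      plug-times (suc n) {C} {φ} = cong (plug C) (plug-times n)

      plug-iterˢ : ∀ C φ → plug (iterˢ C) φ ≡ iter s (plug C) φ
      plug-iterˢ C φ = trans (fold (reverse x)) (trans (cong (λ n → iter n (plug C) (plug (iterᵖ C) φ)) (length-reverse x))
                                                        (sym (iter-+ (length x) _)))
        where
        fold : ∀ (w : List Bool) {ψ} → foldr (λ _ → plug C) ψ w ≡ iter (length w) (plug C) ψ
        fold []      = refl
        fold (_ ∷ w) = cong (plug C) (fold w)

      copies-of : ℕ → List Bool → List Bool
      copies-of n u = iter n (u ++_) []

      generate-repeat : ∀ n e → generate (repeat n e) x ≡ copies-of n (generate e x)
      generate-repeat zero    e = refl
      generate-repeat (suc n) e = cong (generate e x ++_) (generate-repeat n e)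

      copies-of-++ : ∀ m n u → copies-of (m + n) u ≡ copies-of m u ++ copies-of n u
      copies-of-++ zero    n u = refl
      copies-of-++ (suc m) n u = trans (cong (u ++_) (copies-of-++ m n u)) (sym (++-assoc u _ _))

      copies-of-* : ∀ m n u → copies-of (m * n) u ≡ copies-of m (copies-of n u)
      copies-of-* zero    n u = refl
      copies-of-* (suc m) n u = trans (copies-of-++ n (m * n) u) (cong (copies-of n u ++_) (copies-of-* m n u))

      generate-for : ∀ e → generate (for (const e)) x ≡ copies-of (length x) (generate e x)
      generate-for e = trans (loop (reverse x)) (cong (λ n → copies-of n (generate e x)) (length-reverse x))
        where
        loop : ∀ (w : List Bool) → concatMap (λ _ → generate e x) w ≡ copies-of (length w) (generate e x)
        loop []      = refl
        loop (_ ∷ w) = cong (generate e x ++_) (loop w)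

      generate-power : ∀ q e → generate (power q e) x ≡ copies-of (⟦ q ⟧ (length x)) (generate e x)
      generate-power []      e = refl
      generate-power (c ∷ q) e = trans
        (cong₂ _++_ (generate-repeat c e)
          (trans (generate-for (power q e))
          (trans (cong (copies-of (length x)) (generate-power q e))
                 (sym (copies-of-* (length x) _ _)))))
        (sym (copies-of-++ c _ _))

      digits-+ : ∀ m n → replicate m true ++ digits n ≡ digits (m + n)
      digits-+ zero    n = refl
      digits-+ (suc m) n = cong (true ∷_) (digits-+ m n)

      digits-* : ∀ m n k → copies-of m (replicate n true) ++ digits k ≡ digits (m * n + k)
      digits-* zero    n k = refl
      digits-* (suc m) n k = trans (++-assoc (replicate n true) _ _)
        (trans (cong (replicate n true ++_) (digits-* m n k))
        (trans (digits-+ n _) (cong digits (sym (+-assoc n (m * n) k)))))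

      plug-text : ∀ C φ → generate (contextText C) x ++ code φ ≡ code (plug C φ)
      instantiate-text : ∀ T → generate (templateText T) x ≡ code (instantiate T)

      plug-text some       φ = refl
      plug-text all        φ = refl
      plug-text (assert T) φ = cong (λ u → true ∷ false ∷ false ∷ u ++ code φ) (instantiate-text T)
      plug-text skip       φ = refl
      plug-text (C ⨟ D)    φ = trans (++-assoc (generate (contextText C) x) _ _)
        (trans (cong (generate (contextText C) x ++_) (plug-text D φ)) (plug-text C _))
      plug-text (iterᵖ C)  φ = trans (cong (_++ code φ) (generate-power p (contextText C))) (loop (⟦ p ⟧ (length x)))
        where
        loop : ∀ n → copies-of n (generate (contextText C) x) ++ code φ ≡ code (iter n (plug C) φ)
        loop zero    = refl
        loop (suc n) = trans (++-assoc (generate (contextText C) x) _ _)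
          (trans (cong (generate (contextText C) x ++_) (loop n)) (plug-text C _))
      plug-text (forInput f) φ = loop (reverse x)
        where
        loop : ∀ w → concatMap (λ b → generate (contextText (f b)) x) w ++ code φ ≡ code (foldr (λ b → plug (f b)) φ w)
        loop []      = refl
        loop (b ∷ w) = trans (++-assoc (generate (contextText (f b)) x) _ _)
          (trans (cong (generate (contextText (f b)) x ++_) (loop w)) (plug-text (f b) _))

      instantiate-text (lit b (α , β)) = cong (λ u → false ∷ digits (toℕ (polarity b)) ++ u)
        (trans (cong (_++ digits β) (trans (cong₂ _++_ (generate-for 1^α) (generate-power p 1^α))
                                           (sym (copies-of-++ (length x) _ _))))
               (trans (digits-* s α β) (cong (λ k → digits (k + β)) (*-comm s α))))
        where 1^α = emit (replicate α true)
      instantiate-text (T ∧ᵗ U) = cong (λ u → true ∷ false ∷ false ∷ u) (cong₂ _++_ (instantiate-text T) (instantiate-text U))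
      instantiate-text (T ∨ᵗ U) = cong (λ u → true ∷ false ∷ true ∷ u) (cong₂ _++_ (instantiate-text T) (instantiate-text U))
      instantiate-text (C ◃ T)  = trans (cong (generate (contextText C) x ++_) (instantiate-text T)) (plug-text C _)

-- Blocks of existential quantifiers with constraints

module Blocks where

  open QuantifiedFormulas
  open FormulaTemplates

  ◂-cong : ∀ b {E E′} → E ≗ E′ → (b ◂ E) ≗ (b ◂ E′)
  ◂-cong b eq zero    = refl
  ◂-cong b eq (suc i) = eq i

  True-cong : ∀ φ {E E′} → E ≗ E′ → True E φ → True E′ φ
  True-cong (lit b i) eq   = trans (sym (eq i))
  True-cong (φ ∧ᵠ ψ)  eq   = map (True-cong φ eq) (True-cong ψ eq)
  True-cong (φ ∨ᵠ ψ)  eq   = Sum.map (True-cong φ eq) (True-cong ψ eq)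
  True-cong (some φ)  eq   = map₂ λ {b} → True-cong φ (◂-cong b eq)
  True-cong (all φ)   eq t b = True-cong φ (◂-cong b eq) (t b)

  Extends : ℕ → Env → Env → Set
  Extends r E′ E = ∀ i → E′ (r + i) ≡ E i

  Extends-trans : ∀ {q r E″ E′ E} → Extends q E″ E′ → Extends r E′ E → Extends (q + r) E″ E
  Extends-trans {q} {r} {E″} f g i = trans (cong E″ (+-assoc q r i)) (trans (f (r + i)) (g i))

  module _ {φ : QF} where

    somes-intro : ∀ r {E E′} → Extends r E′ E → True E′ φ → True E (iter r some φ)
    somes-intro zero    ext t = True-cong φ ext t
    somes-intro (suc r) {E} {E′} ext t = E′ r , somes-intro r ext′ t
      where
      ext′ : Extends r E′ (E′ r ◂ E)
      ext′ zero    = cong E′ (+-identityʳ r)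
      ext′ (suc i) = trans (cong E′ (+-suc r i)) (ext i)

    somes-elim : ∀ r {E} → True E (iter r some φ) → ∃[ E′ ] Extends r E′ E × True E′ φ
    somes-elim zero    t = _ , (λ _ → refl) , t
    somes-elim (suc r) (b , t) with E′ , ext , t′ ← somes-elim r t =
      E′ , (λ i → trans (cong E′ (sym (+-suc r i))) (ext (suc i))) , t′

  block : ℕ → QF → QF → QF
  block r C φ = iter r some (C ∧ᵠ φ)

  from : ℕ → Env → Env
  from n E i = E (n + i)

  -- Block i is followed by i blocks bound later. Dropping these restores the environment in which
  -- its constraint stands, so one constraint with fixed indices sees a different part of the outer
  -- environment in each block.
  Blocks : ℕ → ℕ → QF → Env → Set
  Blocks n r C E = ∀ i → i < n → True (from (i * r) E) C

  module _ {r : ℕ} {C φ : QF} where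

    blocks-intro : ∀ n {E E′} → Extends (n * r) E′ E → Blocks n r C E′ → True E′ φ → True E (iter n (block r C) φ)
    blocks-intro zero ext cs t = True-cong φ ext t
    blocks-intro (suc n) {E} {E′} ext cs t = somes-intro r {E′ = from (n * r) E′} ext′
      (cs n ≤-refl , blocks-intro n (λ _ → refl) (λ i i<n → cs i (m≤n⇒m≤1+n i<n)) t)
      where
      ext′ : Extends r (from (n * r) E′) E
      ext′ i = trans (cong E′ (trans (sym (+-assoc (n * r) r i)) (cong (_+ i) (+-comm (n * r) r)))) (ext i)

    blocks-elim : ∀ n {E} → True E (iter n (block r C) φ) →
                  ∃[ E′ ] Extends (n * r) E′ E × Blocks n r C E′ × True E′ φ
    blocks-elim zero    t = _ , (λ _ → refl) , (λ _ ()) , t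
    blocks-elim (suc n) {E} t
      with E₁ , ext₁ , c , t₁ ← somes-elim r t
      with E′ , ext , cs , t′ ← blocks-elim n t₁
      = E′ , ext′ , cs′ , t′
      where
      ext′ : Extends (r + n * r) E′ E
      ext′ i = trans (cong (λ k → E′ (k + i)) (+-comm r (n * r))) (Extends-trans {n * r} {E″ = E′} ext ext₁ i)
      cs′ : Blocks (suc n) r C E′
      cs′ i i<1+n with m<1+n⇒m<n∨m≡n i<1+n
      ... | inj₁ i<n  = cs i i<n
      ... | inj₂ refl = True-cong C (λ i → sym (ext i)) c

  interleave : ℕ → Bool → (ℕ → Bool) → Env → Env
  interleave zero    b g E = E
  interleave (suc n) b g E = b ◂ g 0 ◂ interleave n b (g ∘ suc) E

  interleave-extends : ∀ n {b g E} → Extends (n * 2) (interleave n b g E) E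
  interleave-extends zero    i = refl
  interleave-extends (suc n) {g = g} i = interleave-extends n {g = g ∘ suc} i

  -- The case q = n is the first bit of `E`, from which the chain of equal flags starts.
  interleave-even : ∀ {n b g E q} → E 0 ≡ b → q ≤ n → interleave n b g E (q * 2) ≡ b
  interleave-even {zero}  eq z≤n       = eq
  interleave-even {suc n} eq z≤n       = refl
  interleave-even {suc n} {g = g} eq (s≤s q≤n) = interleave-even {n} {g = g ∘ suc} eq q≤n

  interleave-odd : ∀ {n b g E q} → q < n → interleave n b g E (suc (q * 2)) ≡ g q
  interleave-odd {suc n} z<s                = refl
  interleave-odd {suc n} {g = g} (s<s q<n@(s≤s _)) = interleave-odd {n} {g = g ∘ suc} q<n

-- Savitch's recursion for stack machines

module StackMachines where

  open QuantifiedFormulas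
  open FormulaTemplates
  open Blocks

  -- What happens to a stack of bits in a step: it loses its top, its top is
  -- overwritten, or its top is overwritten by two bits (the new top first).
  data Operation : Set where
    pop     : Operation
    replace : Bool → Operation
    push    : Bool → Bool → Operation

  advance : Operation → (ℕ → Bool) → ℕ → Bool
  advance pop         u i             = u (suc i)
  advance (replace a) u zero          = a
  advance (replace a) u (suc i)       = u (suc i)
  advance (push a b)  u zero          = a
  advance (push a b)  u (suc zero)    = b
  advance (push a b)  u (suc (suc i)) = u (suc i)

  nth : List Bool → ℕ → Maybe Bool
  nth []      i       = nothing
  nth (b ∷ x) zero    = just b
  nth (b ∷ x) (suc i) = nth x i

  constant-below : ∀ n {f : ℕ → Bool} {b} → (∀ q → q < n → f q ≡ f (suc q)) → f n ≡ b → ∀ {q} → q ≤ n → f q ≡ b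
  constant-below zero    h eq z≤n = eq
  constant-below (suc n) h eq {q} q≤1+n with m≤n⇒m<n∨m≡n q≤1+n
  ... | inj₁ (s≤s q≤n) = constant-below n (λ q q<n → h q (m≤n⇒m≤1+n q<n)) (trans (h n ≤-refl) eq) q≤n
  ... | inj₂ refl      = eq

  -- A machine with D stacks of bits, controlled by the column of their tops.
  module StackMachine
    (p : Polynomial) (D : ℕ)
    (operation : Vec Bool D → Fin D → Operation)
    (accept : Vec Bool D → Bool)
    (colour : Maybe Bool → Fin D → Bool) where

    open Templates p

    Stacks : Set
    Stacks = ℕ → Fin D → Bool

    evolve : Stacks → Stacks
    evolve c i j = advance (operation (tabulate (c 0)) j) (λ i → c i j) i

    load : List Bool → Stacks
    load x i = colour (nth x i)

    width : ℕ
    width = D * 2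

    -- Each bit of a configuration is preceded by a copy of the bit that the
    -- universal player chose last, so that the two stay at a constant distance.
    place : ℕ → Fin D → ℕ
    place i j = i * width + suc (toℕ j * 2)

    infix 8 _L+_
    -- A block consists of (2 + s) · `width` bits, so a multiple of its length is again affine in s.
    _L+_ : ℕ → ℕ → Index
    c L+ β = c * width , c * (2 * width) + β

    -- Adds s · `width`, the number of dummy bits that `stepping` binds in all.
    scanned : Index → Index
    scanned (α , β) = width + α , β

    equal : Index → Index → Template
    equal i j = (lit true i ∧ᵗ lit true j) ∨ᵗ (lit false i ∧ᵗ lit false j)

    ⊤ᵗ ⊥ᵗ : Template
    ⊤ᵗ = some ◃ lit true (0 , 0)
    ⊥ᵗ = all ◃ lit true (0 , 0)

    every : ∀ n → (Fin n → Template) → Template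
    every zero    T = ⊤ᵗ
    every (suc n) T = T zero ∧ᵗ every n (T ∘ suc)

    -- A case distinction over all valuations of n bits. It is affordable because it is used for the
    -- D stack tops, and D depends on the machine alone.
    select : ∀ n → (Fin n → Index) → (Vec Bool n → Template) → Template
    select zero    i T = T []
    select (suc n) i T =
      (lit true (i zero) ∧ᵗ select n (i ∘ suc) (T ∘ (true ∷_))) ∨ᵗ
      (lit false (i zero) ∧ᵗ select n (i ∘ suc) (T ∘ (false ∷_)))

    pairs : Context → Context
    pairs C = times D C ⨟ times D C ⨟ iterˢ (times D C)

    blockᶜ : ℕ → Template → Context
    blockᶜ r C = times r some ⨟ assert C

    -- Index 0 is the new flag, 1 the new bit, and 2 the flag of the pair bound before it, or the
    -- universal bit itself in the case of the first pair. Binding a pair moves the sources two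
    -- places away while the next bit wanted lies two places nearer, so `a` and `b` remain constant.
    copying : Index → Index → Template
    copying a b =
      equal (0 , 0) (0 , 2) ∧ᵗ
      ((lit true (0 , 0) ∧ᵗ equal (0 , 1) a) ∨ᵗ (lit false (0 , 0) ∧ᵗ equal (0 , 1) b))

    mux : Index → Index → Context
    mux a b = pairs (blockᶜ 2 (copying a b))

    free : Context
    free = pairs (some ⨟ some)

    -- Savitch's step, from a formula on the top two blocks v, u (end and start of a
    -- path) to one on paths twice as long: guess the middle w, let b be chosen
    -- universally, and copy (u , w) if b is true and (w , v) if b is false.
    double : Context
    double = free ⨟ all ⨟ mux (3 L+ 2) (1 L+ 2) ⨟ mux (2 L+ 2) (3 L+ 2)

    -- Fixes the two rows of the new stack that `moving` does not reach: the last two for a pop, the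
    -- first and the last for a replacement, the first two for a push. This is why a block has two
    -- rows more than s.
    boundary : Operation → Fin D → Template
    boundary pop         j = lit false (width , place 0 j) ∧ᵗ lit false (width , place 1 j)
    boundary (replace a) j = lit a (0 , place 0 j) ∧ᵗ lit false (width , place 1 j)
    boundary (push a b)  j = lit a (0 , place 0 j) ∧ᵗ lit b (0 , place 1 j)

    shift : Operation → ℕ
    shift pop         = 0
    shift (replace _) = 1
    shift (push _ _)  = 2

    moving : Operation → Fin D → Template
    moving o j = equal (scanned (0 , place (shift o) j)) (scanned (1 L+ place 1 j))

    -- Binding one dummy column per column of the blocks keeps the indices in
    -- moving constant.
    stepping : (Fin D → Operation) → Template
    stepping o =
      every D (λ j → boundary (o j) j) ∧ᵗ
      (iterˢ (blockᶜ width (every D λ j → moving (o j) j)) ◃ ⊤ᵗ)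

    single : Template
    single = select D (λ j → 1 L+ place 0 j) (stepping ∘ operation)

    acceptingᵗ : Template
    acceptingᵗ = select D (λ j → 0 , place 0 j) (λ κ → if accept κ then ⊤ᵗ else ⊥ᵗ)

    coloured : Maybe Bool → Context
    coloured σ = blockᶜ width (every D λ j → lit (colour σ j) (0 , place 0 j))

    -- The outermost quantifiers bind the deepest rows: blanks come first, then the input from its
    -- last bit to its first, which ends up in row 0. There are 2 + s rows in all.
    loading : Context
    loading = coloured nothing ⨟ coloured nothing ⨟ iterᵖ (coloured nothing) ⨟ forInput (coloured ∘ just)

    -- The start block is loaded and the end block guessed. The s · D doublings cover 2 ^ (s · D)
    -- steps, one for each possible content of D stacks of height s.
    acceptance : Template
    acceptance = loading ◃ free ◃ (acceptingᵗ ∧ᵗ (iterˢ (times D double) ◃ single))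

    module _ (x : List Bool) where

      private
        S L N : ℕ
        S = 2 + s x
        L = S * width
        N = S * D

      N*2≡L : N * 2 ≡ L
      N*2≡L = *-assoc S D 2

      ⟪L+⟫ : ∀ c β → ⟪_⟫ x (c L+ β) ≡ c * L + β
      ⟪L+⟫ c β = solve 4
        (λ c β w s → c :* w :* s :+ (c :* (con 2 :* w) :+ β) := c :* ((con 2 :+ s) :* w) :+ β)
        refl c β width (s x)

      ⟪scanned⟫ : ∀ i → ⟪_⟫ x (scanned i) ≡ s x * width + ⟪_⟫ x i
      ⟪scanned⟫ (α , β) = solve 4 (λ α β w s → (w :+ α) :* s :+ β := s :* w :+ (α :* s :+ β)) refl α β width (s x)

      infix 4 _⊩_
      _⊩_ : Env → Template → Set
      E ⊩ T = True E (instantiate x T)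

      equal-intro : ∀ {E i j} → E (⟪_⟫ x i) ≡ E (⟪_⟫ x j) → E ⊩ equal i j
      equal-intro {E} {i} {j} eq with E (⟪_⟫ x j) in eq′
      ... | true  = inj₁ (eq , refl)
      ... | false = inj₂ (eq , refl)

      equal-elim : ∀ {E i j} → E ⊩ equal i j → E (⟪_⟫ x i) ≡ E (⟪_⟫ x j)
      equal-elim (inj₁ (p , q)) = trans p (sym q)
      equal-elim (inj₂ (p , q)) = trans p (sym q)

      ⊥ᵗ-elim : ∀ {E} {A : Set} → E ⊩ ⊥ᵗ → A
      ⊥ᵗ-elim t with () ← t false

      every-intro : ∀ {E} n {T} → (∀ j → E ⊩ T j) → E ⊩ every n T
      every-intro zero    t = true , refl
      every-intro (suc n) t = t zero , every-intro n (t ∘ suc)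

      every-elim : ∀ {E} n {T} → E ⊩ every n T → ∀ j → E ⊩ T j
      every-elim (suc n) (t , ts) zero    = t
      every-elim (suc n) (t , ts) (suc j) = every-elim n ts j

      select-intro : ∀ {E} n {i T} → E ⊩ T (tabulate (E ∘ ⟪_⟫ x ∘ i)) → E ⊩ select n i T
      select-intro zero    t = t
      select-intro {E} (suc n) {i} t with E (⟪_⟫ x (i zero)) in eq
      ... | true  = inj₁ (refl , select-intro n t)
      ... | false = inj₂ (refl , select-intro n t)

      select-elim : ∀ {E} n {i T} → E ⊩ select n i T → E ⊩ T (tabulate (E ∘ ⟪_⟫ x ∘ i))
      select-elim zero    t = t
      select-elim (suc n) (inj₁ (eq , t)) rewrite eq = select-elim n t
      select-elim (suc n) (inj₂ (eq , t)) rewrite eq = select-elim n t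

      plug-pairs : ∀ C φ → plug x (pairs C) φ ≡ iter N (plug x C) φ
      plug-pairs C φ = trans
        (cong (plug x (times D C) ∘ plug x (times D C)) (plug-iterˢ x (times D C) φ))
        (trans (iter-cong S (λ ψ → plug-times x D {C} {ψ})) (sym (iter-* S D)))

      plug-blockᶜ : ∀ r C φ → plug x (blockᶜ r C) φ ≡ block r (instantiate x C) φ
      plug-blockᶜ r C φ = plug-times x r

      -- Says nothing about the flags at the even positions, nor about rows from S on.
      record At (o : ℕ) (E : Env) (c : Stacks) : Set where
        constructor stored
        field
          bit-at : ∀ {i} → i < S → ∀ j → E (o + place i j) ≡ c i j

      open At

      At-extends : ∀ {r o E′ E c} → Extends r E′ E → At o E c → At (r + o) E′ c
      At-extends {r} {o} {E′} ext at .bit-at i<S j =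
        trans (cong E′ (+-assoc r o _)) (trans (ext _) (bit-at at i<S j))

      At-extended : ∀ {r o E′ E c} → Extends r E′ E → At (r + o) E′ c → At o E c
      At-extended {r} {o} {E′} ext at .bit-at i<S j =
        trans (sym (ext _)) (trans (cong E′ (sym (+-assoc r o _))) (bit-at at i<S j))

      place-pair : ∀ i j → place i j ≡ suc ((i * D + toℕ j) * 2)
      place-pair i j = solve 3
        (λ i d j → i :* (d :* con 2) :+ (con 1 :+ j :* con 2) := con 1 :+ (i :* d :+ j) :* con 2)
        refl i D (toℕ j)

      pair-bound : ∀ {i} → i < S → ∀ j → i * D + toℕ j < N
      pair-bound {i} i<S j = begin-strict
        i * D + toℕ j   <⟨ +-monoʳ-< (i * D) (toℕ<n j) ⟩
        i * D + D       ≡⟨ +-comm (i * D) D ⟩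
        suc i * D       ≤⟨ *-monoˡ-≤ D i<S ⟩
        N               ∎
        where open ≤-Reasoning

      -- The field `choice` makes the universal bit available at index 0 again, for the copy that
      -- comes next.
      record Copied (b : Bool) (o : ℕ) (E E′ : Env) : Set where
        constructor copied
        field
          extends : Extends L E′ E
          choice  : E′ 0 ≡ b
          agree   : ∀ {q} → q < N → E′ (suc (q * 2)) ≡ E (o + suc (q * 2))

      Copied-At : ∀ {b o E E′ c} → Copied b o E E′ → At o E c → At 0 E′ c
      Copied-At {o = o} {E} {E′} (copied _ _ agree) at .bit-at {i} i<S j = begin
        E′ (place i j)                        ≡⟨ cong E′ (place-pair i j) ⟩
        E′ (suc ((i * D + toℕ j) * 2))        ≡⟨ agree (pair-bound i<S j) ⟩
        E (o + suc ((i * D + toℕ j) * 2))     ≡⟨ cong (λ k → E (o + k)) (place-pair i j) ⟨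
        E (o + place i j)                     ≡⟨ bit-at at i<S j ⟩
        _                                     ∎
        where open ≡-Reasoning

      At-Copied : ∀ {b o E E′ c} → Copied b o E E′ → At 0 E′ c → At o E c
      At-Copied {o = o} {E} {E′} (copied _ _ agree) at .bit-at {i} i<S j = begin
        E (o + place i j)                     ≡⟨ cong (λ k → E (o + k)) (place-pair i j) ⟩
        E (o + suc ((i * D + toℕ j) * 2))     ≡⟨ agree (pair-bound i<S j) ⟨
        E′ (suc ((i * D + toℕ j) * 2))        ≡⟨ cong E′ (place-pair i j) ⟨
        E′ (place i j)                        ≡⟨ bit-at at i<S j ⟩
        _                                     ∎
        where open ≡-Reasoning

      module _ {a b : Index} {o₁ o₂ : ℕ} (a≡ : ⟪_⟫ x a ≡ suc (L + o₁)) (b≡ : ⟪_⟫ x b ≡ suc (L + o₂)) where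

        source : Bool → ℕ
        source β = if β then o₁ else o₂

        private
          reindex : ∀ q o → q * 2 + suc (L + o) ≡ L + (o + suc (q * 2))
          reindex q o = solve 3 (λ q l o → q :* con 2 :+ (con 1 :+ (l :+ o)) := l :+ (o :+ (con 1 :+ q :* con 2))) refl q L o
          one : ∀ q → q * 2 + 1 ≡ suc (q * 2)
          one q = +-comm (q * 2) 1
          two : ∀ q → q * 2 + 2 ≡ suc q * 2
          two q = +-comm (q * 2) 2

        pair-intro : ∀ β {E′} q → E′ (q * 2) ≡ β → E′ (suc q * 2) ≡ β →
          E′ (suc (q * 2)) ≡ E′ (L + (source β + suc (q * 2))) → from (q * 2) E′ ⊩ copying a b
        pair-intro β {E′} q flag flag′ eq =
          equal-intro {from (q * 2) E′} {0 , 0} {0 , 2}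
            (trans flag₀ (trans (sym flag′) (cong E′ (sym (two q))))) ,
          pick β flag₀ eq
          where
          flag₀ : E′ (q * 2 + 0) ≡ β
          flag₀ = trans (cong E′ (+-identityʳ (q * 2))) flag
          linked : ∀ {i o} → ⟪_⟫ x i ≡ suc (L + o) → E′ (suc (q * 2)) ≡ E′ (L + (o + suc (q * 2))) →
                   from (q * 2) E′ ⊩ equal (0 , 1) i
          linked {i} {o} i≡ eq = equal-intro {from (q * 2) E′} {0 , 1} {i} (trans (cong E′ (one q)) (trans eq
            (cong E′ (sym (trans (cong (q * 2 +_) i≡) (reindex q o))))))
          pick : ∀ β → E′ (q * 2 + 0) ≡ β → E′ (suc (q * 2)) ≡ E′ (L + (source β + suc (q * 2))) →
                 from (q * 2) E′ ⊩ (lit true (0 , 0) ∧ᵗ equal (0 , 1) a) ∨ᵗ (lit false (0 , 0) ∧ᵗ equal (0 , 1) b)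
          pick true  flag eq = inj₁ (flag , linked {a} a≡ eq)
          pick false flag eq = inj₂ (flag , linked {b} b≡ eq)

        pair-elim : ∀ {E′} q → from (q * 2) E′ ⊩ copying a b →
          E′ (q * 2) ≡ E′ (suc q * 2) ×
          (∀ {β} → E′ (q * 2) ≡ β → E′ (suc (q * 2)) ≡ E′ (L + (source β + suc (q * 2))))
        pair-elim {E′} q (flags , choice) =
          trans (cong E′ (sym (+-identityʳ (q * 2))))
            (trans (equal-elim {from (q * 2) E′} {0 , 0} {0 , 2} flags) (cong E′ (two q))) , chosen choice
          where
          linked : ∀ {i o} → ⟪_⟫ x i ≡ suc (L + o) → from (q * 2) E′ ⊩ equal (0 , 1) i →
                   E′ (suc (q * 2)) ≡ E′ (L + (o + suc (q * 2)))
          linked {i} {o} i≡ t = trans (cong E′ (sym (one q))) (trans (equal-elim {from (q * 2) E′} {0 , 1} {i} t)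
            (cong E′ (trans (cong (q * 2 +_) i≡) (reindex q o))))
          chosen : from (q * 2) E′ ⊩ (lit true (0 , 0) ∧ᵗ equal (0 , 1) a) ∨ᵗ (lit false (0 , 0) ∧ᵗ equal (0 , 1) b) →
                   ∀ {β} → E′ (q * 2) ≡ β → E′ (suc (q * 2)) ≡ E′ (L + (source β + suc (q * 2)))
          chosen (inj₁ (flag , t)) refl rewrite trans (sym (cong E′ (+-identityʳ (q * 2)))) flag = linked {a} a≡ t
          chosen (inj₂ (flag , t)) refl rewrite trans (sym (cong E′ (+-identityʳ (q * 2)))) flag = linked {b} b≡ t

        mux-intro : ∀ {β E φ} → E 0 ≡ β → (∀ {E′} → Copied β (source β) E E′ → True E′ φ) →
                    True E (plug x (mux a b) φ)
        mux-intro {β} {E} {φ} E0≡β t rewrite plug-pairs (blockᶜ 2 (copying a b)) φ =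
          blocks-intro {2} {instantiate x (copying a b)} {φ} N {E} {E′} (interleave-extends N {g = g}) pair
            (t (copied extends′ (interleave-even {N} {g = g} {E} E0≡β z≤n) (interleave-odd {N} {g = g})))
          where
          g : ℕ → Bool
          g q = E (source β + suc (q * 2))
          E′ : Env
          E′ = interleave N β g E
          extends′ : Extends L E′ E
          extends′ = subst (λ l → Extends l E′ E) N*2≡L (interleave-extends N {g = g})
          pair : Blocks N 2 (instantiate x (copying a b)) E′
          pair q q<N = pair-intro β {E′} q
            (interleave-even {N} {g = g} {E} E0≡β (<⇒≤ q<N)) (interleave-even {N} {g = g} {E} E0≡β q<N)
            (trans (interleave-odd {N} {g = g} q<N) (sym (extends′ _)))

        mux-elim : ∀ {β E φ} → E 0 ≡ β → True E (plug x (mux a b) φ) →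
                   ∃[ E′ ] Copied β (source β) E E′ × True E′ φ
        mux-elim {β} {E} {φ} E0≡β t
          with E′ , ext , blocks , t′ ← blocks-elim {2} {instantiate x (copying a b)} {φ} N {E}
                                          (subst (True E) (plug-pairs (blockᶜ 2 (copying a b)) φ) t)
          = E′ , copied extends′ (flags z≤n) agree′ , t′
          where
          extends′ : Extends L E′ E
          extends′ = subst (λ l → Extends l E′ E) N*2≡L ext
          -- Position N * 2 of `E′` is the bit at the front of `E`; agreement of neighbouring flags
          -- spreads it through the whole block.
          flags : ∀ {q} → q ≤ N → E′ (q * 2) ≡ β
          flags = constant-below N (λ q q<N → proj₁ (pair-elim {E′} q (blocks q q<N)))
            (trans (cong E′ (sym (+-identityʳ (N * 2)))) (trans (ext 0) E0≡β))
          agree′ : ∀ {q} → q < N → E′ (suc (q * 2)) ≡ E (source β + suc (q * 2))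
          agree′ {q} q<N = trans (proj₂ (pair-elim {E′} q (blocks q q<N)) (flags (<⇒≤ q<N))) (extends′ _)

      plug-free : ∀ φ → plug x free φ ≡ iter (N * 2) some φ
      plug-free φ = trans (plug-pairs (some ⨟ some) φ) (sym (iter-* N 2))

      free-intro : ∀ {E E′ φ} → Extends L E′ E → True E′ φ → True E (plug x free φ)
      free-intro {E} {E′} {φ} ext t = subst (True E) (sym (plug-free φ))
        (somes-intro (N * 2) (subst (λ l → Extends l E′ E) (sym N*2≡L) ext) t)

      free-elim : ∀ {E φ} → True E (plug x free φ) → ∃[ E′ ] Extends L E′ E × True E′ φ
      free-elim {E} {φ} t with E′ , ext , t′ ← somes-elim (N * 2) (subst (True E) (plug-free φ) t)
        = E′ , subst (λ l → Extends l E′ E) N*2≡L ext , t′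

      record-block : ∀ E c → ∃[ E′ ] Extends L E′ E × At 0 E′ c
      record-block E c = E′ , subst (λ l → Extends l E′ E) N*2≡L (interleave-extends N {g = g}) , at
        where
        g : ℕ → Bool
        g q with q <? N
        ... | yes q<N = uncurry (c ∘ toℕ) (remQuot {S} D (fromℕ< q<N))
        ... | no  _   = false
        E′ : Env
        E′ = interleave N false g E
        at : At 0 E′ c
        at .bit-at {i} i<S j = begin
          E′ (place i j)                   ≡⟨ cong E′ (place-pair i j) ⟩
          E′ (suc ((i * D + toℕ j) * 2))   ≡⟨ interleave-odd {N} {g = g} (pair-bound i<S j) ⟩
          g (i * D + toℕ j)                ≡⟨ recorded ⟩
          c i j                            ∎
          where
          open ≡-Reasoning
          recorded : g (i * D + toℕ j) ≡ c i j
          recorded with i * D + toℕ j <? N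
          ... | no  q≮N = contradiction (pair-bound i<S j) q≮N
          ... | yes q<N = trans (cong (uncurry (c ∘ toℕ) ∘ remQuot {S} D) position)
                            (trans (cong (uncurry (c ∘ toℕ)) (remQuot-combine (fromℕ< i<S) j))
                              (cong (λ k → c k j) (toℕ-fromℕ< i<S)))
            where
            position : fromℕ< q<N ≡ combine (fromℕ< i<S) j
            position = toℕ-injective (trans (toℕ-fromℕ< q<N) (sym (trans (toℕ-combine (fromℕ< i<S) j)
              (cong (_+ toℕ j) (trans (cong (D *_) (toℕ-fromℕ< i<S)) (*-comm D i))))))

      pad : ℕ → Env → Env
      pad r = iter r (false ◂_)

      pad-extends : ∀ r {E} → Extends r (pad r E) E
      pad-extends zero    i = refl
      pad-extends (suc r) i = pad-extends r i

      Ends : Operation → (ℕ → Bool) → Set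
      Ends pop         v = v (s x) ≡ false × v (1 + s x) ≡ false
      Ends (replace a) v = v 0 ≡ a × v (1 + s x) ≡ false
      Ends (push a b)  v = v 0 ≡ a × v 1 ≡ b

      Shifted : Operation → (ℕ → Bool) → (ℕ → Bool) → Set
      Shifted o u v = ∀ {i} → i < s x → v (shift o + i) ≡ u (suc i)

      module _ {u v : ℕ → Bool} where

        -- `Shifted` accounts for s of the 2 + s rows and `Ends` for the other two. Rows at the
        -- bottom that a pop or a replacement sets to `false` have the right value because the old
        -- stack is `false` from height s on.
        advance-elim : ∀ o → (∀ {i} → s x ≤ i → u i ≡ false) → Ends o v → Shifted o u v →
                       ∀ {i} → i < S → v i ≡ advance o u i
        advance-elim pop small (v₁ , v₂) shifted {i} i<S with m<1+n⇒m<n∨m≡n i<S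
        ... | inj₂ refl = trans v₂ (sym (small (m≤n⇒m≤1+n (n≤1+n (s x)))))
        ... | inj₁ i<1+s with m<1+n⇒m<n∨m≡n i<1+s
        ...   | inj₂ refl = trans v₁ (sym (small (n≤1+n (s x))))
        ...   | inj₁ i<s  = shifted i<s
        advance-elim (replace a) small (v₁ , v₂) shifted {zero}  _ = v₁
        advance-elim (replace a) small (v₁ , v₂) shifted {suc i} (s<s i<1+s) with m<1+n⇒m<n∨m≡n i<1+s
        ... | inj₂ refl = trans v₂ (sym (small (n≤1+n (s x))))
        ... | inj₁ i<s  = shifted i<s
        advance-elim (push a b) small (v₁ , v₂) shifted {zero}        _ = v₁
        advance-elim (push a b) small (v₁ , v₂) shifted {suc zero}    _ = v₂
        advance-elim (push a b) small (v₁ , v₂) shifted {suc (suc i)} (s<s (s<s i<s)) = shifted i<s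

        module _ (small : ∀ {i} → s x ≤ i → u i ≡ false) where

          ends-intro : ∀ o → (∀ {i} → i < S → v i ≡ advance o u i) → Ends o v
          ends-intro pop         v≡ = trans (v≡ (s≤s (n≤1+n _))) (small (n≤1+n _)) ,
                                      trans (v≡ ≤-refl) (small (m≤n⇒m≤1+n (n≤1+n _)))
          ends-intro (replace a) v≡ = v≡ z<s , trans (v≡ ≤-refl) (small (n≤1+n _))
          ends-intro (push a b)  v≡ = v≡ z<s , v≡ (s<s z<s)

        shifted-intro : ∀ o → (∀ {i} → i < S → v i ≡ advance o u i) → Shifted o u v
        shifted-intro pop         v≡ i<s = v≡ (m≤n⇒m≤1+n (m≤n⇒m≤1+n i<s))
        shifted-intro (replace a) v≡ i<s = v≡ (s<s (m≤n⇒m≤1+n i<s))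
        shifted-intro (push a b)  v≡ i<s = v≡ (s<s (s<s i<s))

      far : ∀ i j → ⟪_⟫ x (width , place i j) ≡ place (i + s x) j
      far i j = solve 4 (λ w s i k → w :* s :+ (i :* w :+ k) := (i :+ s) :* w :+ k) refl width (s x) i (suc (toℕ j * 2))

      module _ {E : Env} (j : Fin D) where

        private
          v : ℕ → Bool
          v i = E (place i j)

        boundary-intro : ∀ o → Ends o v → E ⊩ boundary o j
        boundary-intro pop         (e , e′) = trans (cong E (far 0 j)) e , trans (cong E (far 1 j)) e′
        boundary-intro (replace a) (e , e′) = e , trans (cong E (far 1 j)) e′
        boundary-intro (push a b)  ends     = ends

        boundary-elim : ∀ o → E ⊩ boundary o j → Ends o v
        boundary-elim pop         (e , e′) = trans (cong E (sym (far 0 j))) e , trans (cong E (sym (far 1 j))) e′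
        boundary-elim (replace a) (e , e′) = e , trans (cong E (sym (far 1 j))) e′
        boundary-elim (push a b)  ends     = ends

      plug-columns : ∀ n C φ → iter n (plug x (blockᶜ width C)) φ ≡ iter n (block width (instantiate x C)) φ
      plug-columns n C φ = iter-cong n (plug-blockᶜ width C)

      module _ (o : Fin D → Operation) where

        private
          C : Template
          C = every D λ j → moving (o j) j

          scan≡ : plug x (iterˢ (blockᶜ width C)) (instantiate x ⊤ᵗ) ≡
                  iter (s x) (block width (instantiate x C)) (instantiate x ⊤ᵗ)
          scan≡ = trans (plug-iterˢ x (blockᶜ width C) _) (plug-columns (s x) C _)

        module _ {E E′ : Env} (ext : Extends (s x * width) E′ E) where

          -- With i dummy columns still to be bound, the fixed index of row k points i rows deeper.
          scanned-target : ∀ i j k → E′ (i * width + ⟪_⟫ x (scanned (0 , place k j))) ≡ E (place (k + i) j)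
          scanned-target i j k = trans (cong E′ (trans (cong (i * width +_) (⟪scanned⟫ (0 , place k j)))
            (solve 5 (λ i s w k l → i :* w :+ (s :* w :+ (k :* w :+ l)) := s :* w :+ ((k :+ i) :* w :+ l))
              refl i (s x) width k (suc (toℕ j * 2)))))
            (ext (place (k + i) j))

          scanned-source : ∀ i j → E′ (i * width + ⟪_⟫ x (scanned (1 L+ place 1 j))) ≡ E (L + 0 + place (suc i) j)
          scanned-source i j = trans (cong E′ (trans
            (cong (i * width +_)
              (trans (⟪scanned⟫ (1 L+ place 1 j)) (cong (s x * width +_) (⟪L+⟫ 1 (place 1 j)))))
            (solve 5 (λ i s w L l → i :* w :+ (s :* w :+ (con 1 :* L :+ (con 1 :* w :+ l)))
                                    := s :* w :+ (L :+ con 0 :+ ((con 1 :+ i) :* w :+ l)))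
              refl i (s x) width L (suc (toℕ j * 2)))))
            (ext _)

        stepping-intro : ∀ {E} → (∀ j → Ends (o j) (λ i → E (place i j))) →
          (∀ j → Shifted (o j) (λ i → E (L + 0 + place i j)) (λ i → E (place i j))) → E ⊩ stepping o
        stepping-intro {E} ends shifted =
          every-intro D (λ j → boundary-intro j (o j) (ends j)) ,
          subst (True E) (sym scan≡) (blocks-intro {C = instantiate x C} (s x) {E} {E′} ext columns (true , refl))
          where
          E′ : Env
          E′ = pad (s x * width) E
          ext : Extends (s x * width) E′ E
          ext = pad-extends (s x * width)
          columns : Blocks (s x) width (instantiate x C) E′
          columns i i<s = every-intro D λ j → equal-intro {from (i * width) E′}
            {scanned (0 , place (shift (o j)) j)} {scanned (1 L+ place 1 j)}
            (trans (scanned-target {E} {E′} ext i j (shift (o j))) (trans (shifted j i<s) (sym (scanned-source {E} {E′} ext i j))))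

        stepping-elim : ∀ {E} → E ⊩ stepping o → ∀ j → Ends (o j) (λ i → E (place i j)) ×
          Shifted (o j) (λ i → E (L + 0 + place i j)) (λ i → E (place i j))
        stepping-elim {E} (ends , t) j
          with E′ , ext , columns , _ ← blocks-elim {C = instantiate x C} (s x) (subst (True E) scan≡ t)
          = boundary-elim {E} j (o j) (every-elim D ends j) , λ {i} i<s →
            trans (sym (scanned-target {E} {E′} ext i j (shift (o j))))
              (trans (equal-elim {from (i * width) E′} {scanned (0 , place (shift (o j)) j)} {scanned (1 L+ place 1 j)}
                        (every-elim {from (i * width) E′} D (columns i i<s) j))
                     (scanned-source {E} {E′} ext i j))

      lit-row : Maybe Bool → Template
      lit-row σ = every D λ j → lit (colour σ j) (0 , place 0 j)

      private
        loaded : List Bool → QF → QF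
        loaded w φ = foldl (λ φ b → plug x (coloured (just b)) φ) φ w

      loaded-elim : ∀ w {E φ} → True E (loaded w φ) → ∃[ E′ ] Extends (length w * width) E′ E ×
        (∀ {i} → i < length w → ∀ j → E′ (place i j) ≡ colour (nth w i) j) × True E′ φ
      loaded-elim []      t = _ , (λ _ → refl) , (λ ()) , t
      loaded-elim (b ∷ w) {E} {φ} t
        with E₁ , ext₁ , rows , t₁ ← loaded-elim w t
        with E₂ , ext₂ , row , t₂ ← somes-elim width (subst (True E₁) (plug-blockᶜ width (lit-row (just b)) φ) t₁)
        = E₂ , Extends-trans {width} {length w * width} {E₂} ext₂ ext₁ , rows′ , t₂
        where
        rows′ : ∀ {i} → i < length (b ∷ w) → ∀ j → E₂ (place i j) ≡ colour (nth (b ∷ w) i) j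
        rows′ {zero}  _         j = every-elim {E₂} D row j
        rows′ {suc i} (s<s i<w) j = trans (cong E₂ (+-assoc width (i * width) _)) (trans (ext₂ _) (rows i<w j))

      loaded-intro : ∀ w {E E′ φ} → Extends (length w * width) E′ E →
        (∀ {i} → i < length w → ∀ j → E′ (place i j) ≡ colour (nth w i) j) → True E′ φ → True E (loaded w φ)
      loaded-intro []      {φ = φ} ext rows t = True-cong φ ext t
      loaded-intro (b ∷ w) {E} {E′} {φ} ext rows t = loaded-intro w {E} {from width E′}
        (λ i → trans (cong E′ (sym (+-assoc width _ i))) (ext i))
        (λ {i} i<w j → trans (cong E′ (sym (+-assoc width (i * width) _))) (rows (s<s i<w) j))
        (subst (True (from width E′)) (sym (plug-blockᶜ width (lit-row (just b)) φ))
          (somes-intro width (λ _ → refl) (every-intro {E′} D (rows z<s) , t)))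

      private
        blanks : ℕ
        blanks = 2 + ⟦ p ⟧ (length x)

        loading≡ : ∀ φ → plug x loading φ ≡ iter blanks (block width (instantiate x (lit-row nothing))) (loaded x φ)
        loading≡ φ = trans
          (cong (iter blanks (plug x (coloured nothing))) (reverse-foldr (λ b → plug x (coloured (just b))) φ x))
          (plug-columns blanks (lit-row nothing) _)

        columns≡ : length x + blanks ≡ S
        columns≡ = trans (+-suc (length x) _) (cong suc (+-suc (length x) _))

        total : length x * width + blanks * width ≡ L
        total = trans (sym (*-distribʳ-+ width (length x) blanks)) (cong (_* width) columns≡)

        nth-beyond : ∀ w i → nth w (length w + i) ≡ nothing
        nth-beyond []      i = refl
        nth-beyond (_ ∷ w) i = nth-beyond w i

        place-+ : ∀ m i j → place (m + i) j ≡ m * width + place i j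
        place-+ m i j = solve 4 (λ m i w l → (m :+ i) :* w :+ l := m :* w :+ (i :* w :+ l)) refl m i width (suc (toℕ j * 2))

      private
        k<blanks : ∀ k → length x + k < S → k < blanks
        k<blanks k lt = +-cancelˡ-< (length x) k blanks
          (subst (length x + k <_) (sym columns≡) lt)

      loading-elim : ∀ {E φ} → True E (plug x loading φ) → ∃[ E′ ] Extends L E′ E × At 0 E′ (load x) × True E′ φ
      loading-elim {E} {φ} t
        with E₁ , ext₁ , empty , t₁ ← blocks-elim {C = instantiate x (lit-row nothing)} blanks (subst (True E) (loading≡ φ) t)
        with E₂ , ext₂ , rows , t₂ ← loaded-elim x t₁
        = E₂ , subst (λ l → Extends l E₂ E) total (Extends-trans {length x * width} {blanks * width} {E₂} ext₂ ext₁) , at , t₂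
        where
        at : At 0 E₂ (load x)
        at .bit-at {i} i<S j with i <? length x
        ... | yes i<n = rows i<n j
        ... | no  i≮n with k , refl ← m≤n⇒∃[o]m+o≡n (≮⇒≥ i≮n) = begin
          E₂ (place (length x + k) j)           ≡⟨ cong E₂ (place-+ (length x) k j) ⟩
          E₂ (length x * width + place k j)     ≡⟨ ext₂ (place k j) ⟩
          E₁ (place k j)                        ≡⟨ every-elim {from (k * width) E₁} D (empty k (k<blanks k i<S)) j ⟩
          colour nothing j                      ≡⟨ cong (λ σ → colour σ j) (nth-beyond x k) ⟨
          colour (nth x (length x + k)) j       ∎
          where open ≡-Reasoning

      loading-intro : ∀ {E E′ φ} → Extends L E′ E → At 0 E′ (load x) → True E′ φ → True E (plug x loading φ)
      loading-intro {E} {E′} {φ} ext at t = subst (True E) (sym (loading≡ φ))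
        (blocks-intro {C = instantiate x (lit-row nothing)} blanks {E} {from (length x * width) E′} ext′ empty
          (loaded-intro x {E′ = E′} (λ _ → refl) (λ i<n → bit-at at (≤-trans i<n (≤-trans (m≤m+n _ _) (m≤n+m _ 2)))) t))
        where
        ext′ : Extends (blanks * width) (from (length x * width) E′) E
        ext′ i = trans (cong E′ (trans (sym (+-assoc (length x * width) (blanks * width) i)) (cong (_+ i) total))) (ext i)
        empty : Blocks blanks width (instantiate x (lit-row nothing)) (from (length x * width) E′)
        empty k k<b = every-intro {from (k * width) (from (length x * width) E′)} D λ j → begin
          E′ (length x * width + place k j)   ≡⟨ cong E′ (place-+ (length x) k j) ⟨
          E′ (place (length x + k) j)         ≡⟨ bit-at at (subst (length x + k <_) columns≡ (+-monoʳ-< (length x) k<b)) j ⟩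
          colour (nth x (length x + k)) j     ≡⟨ cong (λ σ → colour σ j) (nth-beyond x k) ⟩
          colour nothing j                    ∎
          where open ≡-Reasoning

      module _ (small : ∀ t {i} j → s x ≤ i → iter t evolve (load x) i j ≡ false) where

        private
          run : ℕ → Stacks
          run t = iter t evolve (load x)

        -- Restricted to start blocks on the actual run, for which `small` is known. By determinism
        -- the formula then characterises the end block completely.
        Computes : ℕ → QF → Set
        Computes m φ = ∀ {E} t → At (L + 0) E (run t) →
          (True E φ → At 0 E (run (m + t))) × (At 0 E (run (m + t)) → True E φ)

        single-computes : Computes 1 (instantiate x single)
        single-computes {E} t at = elim , intro
          where
          c = run t
          o : Fin D → Operation
          o = operation (tabulate (c 0))
          tops : tabulate (E ∘ ⟪_⟫ x ∘ λ j → 1 L+ place 0 j) ≡ tabulate (c 0)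
          tops = Vec.tabulate-cong λ j → trans (cong E (⟪L+⟫ 1 (place 0 j))) (bit-at at z<s j)
          elim : E ⊩ single → At 0 E (run (suc t))
          elim t′ .bit-at i<S j =
            let ends , shifted = stepping-elim o (subst (λ κ → E ⊩ stepping (operation κ)) tops (select-elim D t′)) j in
            advance-elim (o j) (small t j) ends (λ i<s → trans (shifted i<s) (bit-at at (s<s (m≤n⇒m≤1+n i<s)) j)) i<S
          intro : At 0 E (run (suc t)) → E ⊩ single
          intro at′ = select-intro D (subst (λ κ → E ⊩ stepping (operation κ)) (sym tops)
            (stepping-intro o (λ j → ends-intro (small t j) (o j) (λ i<S → bit-at at′ i<S j))
              (λ j i<s → trans (shifted-intro (o j) (λ i<S → bit-at at′ i<S j) i<s)
                             (sym (bit-at at (s<s (m≤n⇒m≤1+n i<s)) j)))))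

        double-computes : ∀ {m φ} → Computes m φ → Computes (m + m) (plug x double φ)
        double-computes {m} {φ} computes {E} t at rewrite +-assoc m m t = elim , intro
          where
          -- After the universal bit the blocks w, v, u start at 1, 1 + L and 1 + (L + L); an index
          -- given to `mux` exceeds the start of its source by 1 + L.
          a₁ : ⟪_⟫ x (3 L+ 2) ≡ suc (L + (1 + (L + (L + 0))))
          a₁ = trans (⟪L+⟫ 3 2) (solve 1 (λ l → con 3 :* l :+ con 2 := con 1 :+ (l :+ (con 1 :+ (l :+ (l :+ con 0))))) refl L)
          b₁ : ⟪_⟫ x (1 L+ 2) ≡ suc (L + (1 + 0))
          b₁ = trans (⟪L+⟫ 1 2) (solve 1 (λ l → con 1 :* l :+ con 2 := con 1 :+ (l :+ con 1)) refl L)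
          -- The first copy has moved all older blocks L places further away.
          a₂ : ⟪_⟫ x (2 L+ 2) ≡ suc (L + (L + (1 + 0)))
          a₂ = trans (⟪L+⟫ 2 2) (solve 1 (λ l → con 2 :* l :+ con 2 := con 1 :+ (l :+ (l :+ con 1))) refl L)
          b₂ : ⟪_⟫ x (3 L+ 2) ≡ suc (L + (L + (1 + (L + 0))))
          b₂ = trans (⟪L+⟫ 3 2) (solve 1 (λ l → con 3 :* l :+ con 2 := con 1 :+ (l :+ (l :+ (con 1 :+ (l :+ con 0))))) refl L)
          under : ∀ {b o E c} → At o E c → At (1 + o) (b ◂ E) c
          under {E = E} = At-extends {1} {E = E} (λ _ → refl)
          out : ∀ {b o E c} → At (1 + o) (b ◂ E) c → At o E c
          out {E = E} = At-extended {1} {E = E} (λ _ → refl)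
          inner : QF
          inner = plug x (mux (2 L+ 2) (3 L+ 2)) φ
          elim : True E (plug x double φ) → At 0 E (run (m + (m + t)))
          elim u =
            let E₁ , ext₁ , u₁ = free-elim {E} {all (plug x (mux (3 L+ 2) (1 L+ 2)) inner)} u
                E₃ , cp₃ , u₃ = mux-elim {3 L+ 2} {1 L+ 2} a₁ b₁ {true} {true ◂ E₁} {inner} refl (u₁ true)
                E₄ , cp₄ , u₄ = mux-elim {2 L+ 2} {3 L+ 2} a₂ b₂ {true} {E₃} {φ} (Copied.choice cp₃) u₃
                F₃ , cq₃ , v₃ = mux-elim {3 L+ 2} {1 L+ 2} a₁ b₁ {false} {false ◂ E₁} {inner} refl (u₁ false)
                F₄ , cq₄ , v₄ = mux-elim {2 L+ 2} {3 L+ 2} a₂ b₂ {false} {F₃} {φ} (Copied.choice cq₃) v₃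
                first  = At-extends (Copied.extends cp₄) (Copied-At cp₃ (under {true} (At-extends ext₁ at)))
                -- The choice `true` identifies the guessed block as `run (m + t)`; this is the
                -- start block needed under the choice `false`.
                middle = out (At-extended (Copied.extends cp₃) (At-Copied cp₄ (proj₁ (computes t first) u₄)))
                second = At-extends (Copied.extends cq₄) (Copied-At cq₃ (under {false} middle))
            in At-extended ext₁ (out (At-extended (Copied.extends cq₃)
                 (At-Copied cq₄ (proj₁ (computes (m + t) second) v₄))))
          intro : At 0 E (run (m + (m + t))) → True E (plug x double φ)
          intro at′ with E₁ , ext₁ , middle ← record-block E (run (m + t)) =
            free-intro {E} {E₁} ext₁ λ where
              true →
                mux-intro {3 L+ 2} {1 L+ 2} a₁ b₁ {true} {true ◂ E₁} refl λ cp₃ →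
                mux-intro {2 L+ 2} {3 L+ 2} a₂ b₂ {true} (Copied.choice cp₃) λ cp₄ →
                proj₂ (computes t (At-extends (Copied.extends cp₄)
                        (Copied-At cp₃ (under {true} (At-extends ext₁ at)))))
                  (Copied-At cp₄ (At-extends (Copied.extends cp₃) (under {true} middle)))
              false →
                mux-intro {3 L+ 2} {1 L+ 2} a₁ b₁ {false} {false ◂ E₁} refl λ cp₃ →
                mux-intro {2 L+ 2} {3 L+ 2} a₂ b₂ {false} (Copied.choice cp₃) λ cp₄ →
                proj₂ (computes (m + t) (At-extends (Copied.extends cp₄) (Copied-At cp₃ (under {false} middle))))
                  (Copied-At cp₄ (At-extends (Copied.extends cp₃) (under {false} (At-extends ext₁ at′))))

        power-computes : ∀ k → Computes (2 ^ k) (iter k (plug x double) (instantiate x single))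
        power-computes zero    = single-computes
        power-computes (suc k) = subst (λ m → Computes m (plug x double (iter k (plug x double) (instantiate x single))))
          (cong (2 ^ k +_) (sym (+-identityʳ (2 ^ k)))) (double-computes {2 ^ k} (power-computes k))

        final : Stacks
        final = run (2 ^ (s x * D))

        private
          path : QF
          path = plug x (iterˢ (times D double)) (instantiate x single)

          path-computes : Computes (2 ^ (s x * D)) path
          path-computes = subst (Computes (2 ^ (s x * D))) (sym path≡) (power-computes (s x * D))
            where
            path≡ : path ≡ iter (s x * D) (plug x double) (instantiate x single)
            path≡ = trans (plug-iterˢ x (times D double) _)
              (trans (iter-cong (s x) (λ φ → plug-times x D {double} {φ})) (sym (iter-* (s x) D)))

          reaches : ∀ {E₁ E₂} → At 0 E₁ (load x) → Extends L E₂ E₁ →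
                    (True E₂ path → At 0 E₂ final) × (At 0 E₂ final → True E₂ path)
          reaches {E₁} {E₂} loaded ext = subst (λ t → (True E₂ path → At 0 E₂ (run t)) × (At 0 E₂ (run t) → True E₂ path))
            (+-identityʳ (2 ^ (s x * D))) (path-computes 0 (At-extends ext loaded))

          tops : ∀ {E} → At 0 E final → tabulate (E ∘ ⟪_⟫ x ∘ λ j → 0 , place 0 j) ≡ tabulate (final 0)
          tops at = Vec.tabulate-cong λ j → bit-at at z<s j

          verdict : Bool → Template
          verdict b = if b then ⊤ᵗ else ⊥ᵗ

          verdict-elim : ∀ b {E} → E ⊩ verdict b → b ≡ true
          verdict-elim true  _ = refl
          verdict-elim false {E} t = ⊥ᵗ-elim {E} t

          verdict-intro : ∀ {b E} → b ≡ true → E ⊩ verdict b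
          verdict-intro refl = true , refl

        acceptance-elim : ∀ {E} → E ⊩ acceptance → accept (tabulate (final 0)) ≡ true
        acceptance-elim {E} t =
          let E₁ , _ , loaded , t₁ = loading-elim {E} {plug x free (instantiate x acceptingᵗ ∧ᵠ path)} t
              E₂ , ext , t₂ , t₃ = free-elim {E₁} {instantiate x acceptingᵗ ∧ᵠ path} t₁
              at = proj₁ (reaches loaded ext) t₃
          in verdict-elim _ {E₂} (subst (λ κ → E₂ ⊩ verdict (accept κ)) (tops at) (select-elim D t₂))

        acceptance-intro : accept (tabulate (final 0)) ≡ true → ∀ E → E ⊩ acceptance
        acceptance-intro accepted E =
          let E₁ , ext₁ , loaded = record-block E (load x)
              E₂ , ext₂ , reached = record-block E₁ final
          in loading-intro ext₁ loaded (free-intro {φ = instantiate x acceptingᵗ ∧ᵠ path} ext₂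
               (select-intro D (subst (λ κ → E₂ ⊩ verdict (accept κ)) (sym (tops reached))
                                   (verdict-intro {E = E₂} accepted)) ,
                proj₂ (reaches loaded ext₂) reached))

-- Space-bounded machines as stack machines

module Simulation where

  open QuantifiedFormulas
  open FormulaTemplates
  open StackMachines

  -- By the pigeonhole principle the sequence is periodic from one of its first M
  -- terms on, and being eventually constant it is constant from there on.
  module _ {X : Set} (_≈_ : X → X → Set)
    (≈-refl : ∀ {a} → a ≈ a) (≈-sym : ∀ {a b} → a ≈ b → b ≈ a) (≈-trans : ∀ {a b c} → a ≈ b → b ≈ c → a ≈ c)
    (r : ℕ → X) (deterministic : ∀ {i j} → r i ≈ r j → r (suc i) ≈ r (suc j))
    {M : ℕ} (label : ℕ → Fin M) (label-injective : ∀ {i j} → label i ≡ label j → r i ≈ r j) where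

    private
      together : ∀ {i j} k → r i ≈ r j → r (i + k) ≈ r (j + k)
      together {i} {j} zero    eq rewrite +-identityʳ i | +-identityʳ j = eq
      together {i} {j} (suc k) eq rewrite +-suc i k | +-suc j k = deterministic (together k eq)

      stays : ∀ {T} → r (suc T) ≈ r T → ∀ k → r (T + k) ≈ r T
      stays {T} fixed zero    rewrite +-identityʳ T = ≈-refl
      stays {T} fixed (suc k) rewrite +-suc T k = ≈-trans (deterministic (stays fixed k)) fixed

      cycle : ∀ {i d} → r i ≈ r (i + suc d) → ∀ m → r i ≈ r (i + m * suc d)
      cycle {i} {d} eq zero    rewrite +-identityʳ i = ≈-refl
      cycle {i} {d} eq (suc m) = ≈-trans eq (subst (λ k → r (i + suc d) ≈ r k)
        (trans (+-assoc i (m * suc d) (suc d)) (cong (i +_) (+-comm (m * suc d) (suc d))))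
        (together (suc d) (cycle eq m)))

      -- After T turns of the cycle the index is at least T, where the sequence is already constant.
      cyclic-limit : ∀ {T i d} → r (suc T) ≈ r T → r i ≈ r (i + suc d) → r i ≈ r T
      cyclic-limit {T} {i} {d} fixed eq = ≈-trans (cycle eq T) (subst (λ k → r k ≈ r T) reorder (stays fixed (i + T * d)))
        where
        reorder : T + (i + T * d) ≡ i + T * suc d
        reorder = trans (trans (sym (+-assoc T i _)) (trans (cong (_+ T * d) (+-comm T i)) (+-assoc i T _)))
          (cong (i +_) (sym (*-suc T d)))

    stationary-by : ∀ {T} → r (suc T) ≈ r T → r M ≈ r T
    stationary-by {T} fixed
      with i , j , i<j , eq ← pigeonhole ≤-refl (λ (i : Fin (suc M)) → label (toℕ i))
      with d , i+d≡j ← m≤n⇒∃[o]m+o≡n i<j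
      with e , i+e≡M ← m≤n⇒∃[o]m+o≡n (≤-pred (toℕ<n i))
      -- From r i ≈ r T, e further steps on both sides give r M ≈ r (T + e).
      = ≈-trans (subst (λ m → r m ≈ r (T + e)) i+e≡M
          (together e (cyclic-limit {d = d} fixed
            (subst (λ k → r (toℕ i) ≈ r k) (sym (trans (+-suc (toℕ i) d) i+d≡j)) (label-injective eq)))))
        (stays fixed e)

  first : ∀ n → (Fin n → Bool) → Maybe (Fin n)
  first zero    f = nothing
  first (suc n) f = if f zero then just zero else Maybe.map suc (first n (f ∘ suc))

  first-cong : ∀ n {f g} → f ≗ g → first n f ≡ first n g
  first-cong zero    eq = refl
  first-cong (suc n) eq rewrite eq zero | first-cong n (eq ∘ suc) = refl

  first-none : ∀ n → first n (const false) ≡ nothing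
  first-none zero    = refl
  first-none (suc n) rewrite first-none n = refl

  oneHot : ∀ {n} → Fin n → Fin n → Bool
  oneHot i j = does (i Fin.≟ j)

  first-oneHot : ∀ {n} (i : Fin n) → first n (oneHot i) ≡ just i
  first-oneHot {suc n} zero    = refl
  first-oneHot {suc n} (suc i) rewrite first-oneHot i = refl

  module Translation (M : Machine) where
    open Machine M hiding (State)

    -- A one-hot code: one stack for each state, and one for each tape, side and nonblank symbol,
    -- these being the two bits and the auxiliary symbols.
    Track : Set
    Track = Fin states ⊎ (Fin tapes × Bool × Fin (2 + auxSymbols))

    Track-finite : Finite Track
    Track-finite = Fin-finite ⊎-finite Fin-finite ×-finite Bool-finite ×-finite Fin-finite

    D : ℕ
    D = size Track-finite

    -- The bits of the start state and of the blank are all false, so that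
    -- nothing but the input has to be loaded.
    stateBits : Fin states → Fin states → Bool
    stateBits q r = if does (q Fin.≟ start) then false else oneHot q r

    -- The default `start` inverts the all-false code of the start state.
    decodeState : (Fin states → Bool) → Fin states
    decodeState f = maybe′ id start (first states f)

    decodeState-stateBits : ∀ q {f} → f ≗ stateBits q → decodeState f ≡ q
    decodeState-stateBits q eq rewrite first-cong states eq with q Fin.≟ start
    ... | yes q≡start rewrite first-none states = sym q≡start
    ... | no  _       rewrite first-oneHot q = refl

    symbolBits : Γ → Fin (2 + auxSymbols) → Bool
    symbolBits blank       = const false
    symbolBits (bit false) = oneHot zero
    symbolBits (bit true)  = oneHot (suc zero)
    symbolBits (aux i)     = oneHot (suc (suc i))

    nonblank : Fin (2 + auxSymbols) → Γ
    nonblank zero          = bit false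
    nonblank (suc zero)    = bit true
    nonblank (suc (suc i)) = aux i

    decodeSymbol : (Fin (2 + auxSymbols) → Bool) → Γ
    decodeSymbol f = maybe′ nonblank blank (first _ f)

    decodeSymbol-symbolBits : ∀ a {f} → f ≗ symbolBits a → decodeSymbol f ≡ a
    decodeSymbol-symbolBits a eq rewrite first-cong _ eq = decoded a
      where
      decoded : ∀ a → maybe′ nonblank blank (first _ (symbolBits a)) ≡ a
      decoded blank rewrite first-none (2 + auxSymbols) = refl
      decoded (bit false) rewrite first-oneHot {2 + auxSymbols} zero = refl
      decoded (bit true) rewrite first-oneHot {2 + auxSymbols} (suc zero) = refl
      decoded (aux i) rewrite first-oneHot {2 + auxSymbols} (suc (suc i)) = refl

    symbolAt : List Γ → ℕ → Γ
    symbolAt []       i       = blank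
    symbolAt (a ∷ as) zero    = a
    symbolAt (a ∷ as) (suc i) = symbolAt as i

    -- The side false of a tape consists of the cells to the left of the head, the
    -- side true of the scanned cell and those to the right.
    side : Bool → Tape auxSymbols → List Γ
    side false t = Tape.leftCells t
    side true  t = Tape.head t ∷ Tape.rightCells t

    trackBit : Config M → Track → ℕ → Bool
    trackBit c (inj₁ r)           zero    = stateBits (Config.state c) r
    trackBit c (inj₁ r)           (suc i) = false
    trackBit c (inj₂ (t , d , w)) i       = symbolBits (symbolAt (side d (lookup (Config.contents c) t)) i) w

    -- The operation on a side of a tape whose head is about to write a and whose
    -- nearest cell on the left contains l.
    sideOperation : Bool → Move → Bool → Bool → Operation
    sideOperation false left  a l = pop
    sideOperation false stay  a l = replace l
    sideOperation false right a l = push a l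
    sideOperation true  left  a l = push l a
    sideOperation true  stay  a l = replace a
    sideOperation true  right a l = pop

    -- Every case holds by computation because cells that are not stored read as blank: storing a
    -- new blank and uncovering an implicit one look alike.
    side-moves : ∀ d m a t w i →
      advance (sideOperation d m (symbolBits a w) (symbolBits (symbolAt (side false t) 0) w))
        (λ i → symbolBits (symbolAt (side d t) i) w) i
      ≡ symbolBits (symbolAt (side d (moveTape m (write a t))) i) w
    side-moves false left  a (tape []       h rs)       w i             = refl
    side-moves false left  a (tape (l ∷ ls) h rs)       w i             = refl
    side-moves false stay  a (tape ls       h rs)       w zero          = refl
    side-moves false stay  a (tape ls       h rs)       w (suc i)       = refl
    side-moves false right a (tape ls       h [])       w zero          = refl
    side-moves false right a (tape ls       h [])       w (suc zero)    = refl
    side-moves false right a (tape ls       h [])       w (suc (suc i)) = refl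
    side-moves false right a (tape ls       h (r ∷ rs)) w zero          = refl
    side-moves false right a (tape ls       h (r ∷ rs)) w (suc zero)    = refl
    side-moves false right a (tape ls       h (r ∷ rs)) w (suc (suc i)) = refl
    side-moves true  left  a (tape []       h rs)       w zero          = refl
    side-moves true  left  a (tape []       h rs)       w (suc zero)    = refl
    side-moves true  left  a (tape []       h rs)       w (suc (suc i)) = refl
    side-moves true  left  a (tape (l ∷ ls) h rs)       w zero          = refl
    side-moves true  left  a (tape (l ∷ ls) h rs)       w (suc zero)    = refl
    side-moves true  left  a (tape (l ∷ ls) h rs)       w (suc (suc i)) = refl
    side-moves true  stay  a (tape ls       h rs)       w zero          = refl
    side-moves true  stay  a (tape ls       h rs)       w (suc i)       = refl
    side-moves true  right a (tape ls       h [])       w zero          = refl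
    side-moves true  right a (tape ls       h [])       w (suc i)       = refl
    side-moves true  right a (tape ls       h (r ∷ rs)) w i             = refl

    module _ (κ : Track → Bool) where

      topState : Fin states
      topState = decodeState (κ ∘ inj₁)

      topSymbol : Bool → Fin tapes → Γ
      topSymbol d t = decodeSymbol (λ w → κ (inj₂ (t , d , w)))

      trackOperation : Maybe (Fin states × Vec (Γ × Move) tapes) → Track → Operation
      -- Rewriting each top with itself makes a halted configuration a fixed point.
      trackOperation nothing         r                  = replace (κ r)
      trackOperation (just (q , as)) (inj₁ r)           = replace (stateBits q r)
      trackOperation (just (q , as)) (inj₂ (t , d , w)) =
        sideOperation d (proj₂ (lookup as t)) (symbolBits (proj₁ (lookup as t)) w) (symbolBits (topSymbol false t) w)

    readTracks : Vec Bool D → Track → Bool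
    readTracks κ r = lookup κ (index Track-finite r)

    operation : Vec Bool D → Fin D → Operation
    operation κ j = trackOperation (readTracks κ)
      (δ (topState (readTracks κ)) (tabulate (topSymbol (readTracks κ) true))) (element Track-finite j)

    accept : Vec Bool D → Bool
    accept κ = accepting (topState (readTracks κ))

    trackColour : Maybe Bool → Track → Bool
    trackColour σ (inj₁ r)                    = false
    trackColour σ (inj₂ (zero  , true  , w)) = symbolBits (maybe′ bit blank σ) w
    trackColour σ (inj₂ (zero  , false , w)) = false
    trackColour σ (inj₂ (suc t , d     , w)) = false

    colour : Maybe Bool → Fin D → Bool
    colour σ j = trackColour σ (element Track-finite j)

    stepOrStay : Config M → Config M
    stepOrStay c = maybe′ id c (step M c)

    tapesSpace : ∀ {k} → Vec (Tape auxSymbols) k → ℕ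
    tapesSpace = Vec.sum ∘ Vec.map (length ∘ cells)

    cells-mono : ∀ m a t → length (cells t) ≤ length (cells (moveTape {auxSymbols} m (write a t)))
    cells-mono left  a (tape []       h rs)
      rewrite length-cells [] h rs | length-cells [] blank (a ∷ rs) = n≤1+n _
    cells-mono left  a (tape (l ∷ ls) h rs)
      rewrite length-cells (l ∷ ls) h rs | length-cells ls l (a ∷ rs) = ≤-reflexive (sym (+-suc (length ls) _))
    cells-mono stay  a (tape ls h rs)
      rewrite length-cells ls h rs | length-cells ls a rs = ≤-refl
    cells-mono right a (tape ls h [])
      rewrite length-cells ls h [] | length-cells (a ∷ ls) blank [] = n≤1+n _
    cells-mono right a (tape ls h (r ∷ rs))
      rewrite length-cells ls h (r ∷ rs) | length-cells (a ∷ ls) r rs = ≤-reflexive (+-suc (length ls) _)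

    tapesSpace-mono : ∀ {k} (as : Vec (Γ × Move) k) ts → tapesSpace ts ≤ tapesSpace (Vec.zipWith (act M) as ts)
    tapesSpace-mono []             []       = z≤n
    tapesSpace-mono ((a , m) ∷ as) (t ∷ ts) = +-mono-≤ (cells-mono m a t) (tapesSpace-mono as ts)

    cells≤tapesSpace : ∀ {k} (ts : Vec (Tape auxSymbols) k) i → length (cells (lookup ts i)) ≤ tapesSpace ts
    cells≤tapesSpace (t ∷ ts) zero    = m≤m+n _ _
    cells≤tapesSpace (t ∷ ts) (suc i) = ≤-trans (cells≤tapesSpace ts i) (m≤n+m _ _)

    side≤cells : ∀ d t → length (side d t) ≤ length (cells t)
    side≤cells false (tape ls h rs) rewrite length-cells ls h rs = m≤m+n _ _
    side≤cells true  (tape ls h rs) rewrite length-cells ls h rs = m≤n+m _ _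

    symbolAt-beyond : ∀ as {i} → length as ≤ i → symbolAt as i ≡ blank
    symbolAt-beyond []       _         = refl
    symbolAt-beyond (a ∷ as) (s≤s a≤i) = symbolAt-beyond as a≤i

    space : Config M → ℕ
    space c = tapesSpace (Config.contents c)

    trackBit-beyond : ∀ c r {i} → space c ≤ i → trackBit c r i ≡ false
    trackBit-beyond c (inj₁ r) {zero} space≤0
      -- The scanned cell always counts, so the space used is never zero and the state bits in row 0
      -- are within bounds.
      with () ← ≤-trans (side≤cells true (lookup (Config.contents c) zero))
                  (≤-trans (cells≤tapesSpace (Config.contents c) zero) space≤0)
    trackBit-beyond c (inj₁ r) {suc i} _ = refl
    trackBit-beyond c (inj₂ (t , d , w)) s≤i = cong (λ a → symbolBits a w)
      (symbolAt-beyond (side d (lookup (Config.contents c) t))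
        (≤-trans (side≤cells d (lookup (Config.contents c) t)) (≤-trans (cells≤tapesSpace (Config.contents c) t) s≤i)))

    space-mono : ∀ c → space c ≤ space (stepOrStay c)
    space-mono c with δ (Config.state c) (Vec.map Tape.head (Config.contents c))
    ... | nothing       = ≤-refl
    ... | just (_ , as) = tapesSpace-mono as (Config.contents c)

    steps-iter : ∀ {t c d} → Steps M t c d → iter t stepOrStay c ≡ d
    steps-iter done = refl
    steps-iter {suc t} {c} (next eq run) = trans (sym (iter-suc t))
      (trans (cong (iter t stepOrStay) (cong (maybe′ id c) eq)) (steps-iter run))

    iter-space : ∀ k c → space c ≤ space (iter k stepOrStay c)
    iter-space zero    c = ≤-refl
    iter-space (suc k) c = ≤-trans (iter-space k c) (space-mono (iter k stepOrStay c))

    halted-stays : ∀ k {c} → step M c ≡ nothing → iter k stepOrStay c ≡ c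
    halted-stays zero    eq = refl
    halted-stays (suc k) {c} eq = trans (cong stepOrStay (halted-stays k eq)) (cong (maybe′ id c) eq)

    module _ {x : List Bool} (h : Halting M x) where

      configAt : ℕ → Config M
      configAt t = iter t stepOrStay (initial M x)

      configAt-final : configAt (Halting.time h) ≡ Halting.final h
      configAt-final = steps-iter (Halting.run h)

      -- Space never decreases, and from any moment on, as many further steps as the whole run takes
      -- end in the final configuration.
      space-configAt : ∀ t → space (configAt t) ≤ Halting.space h
      space-configAt t = subst (λ c → space (configAt t) ≤ space c) eventually (iter-space T (configAt t))
        where
        T = Halting.time h
        eventually : iter T stepOrStay (configAt t) ≡ Halting.final h
        eventually = trans (sym (iter-+ T t)) (trans (cong configAt (+-comm T t))
          (trans (iter-+ t T) (trans (cong (iter t stepOrStay) configAt-final) (halted-stays t (Halting.halted h)))))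

    module _ (p : Polynomial) where

      open Templates p
      open StackMachine p D operation accept colour

      stacks : Config M → Stacks
      stacks c i j = trackBit c (element Track-finite j) i

      infix 4 _≈_
      _≈_ : Stacks → Stacks → Set
      c ≈ d = ∀ i j → c i j ≡ d i j

      advance-cong : ∀ o {u v} → u ≗ v → advance o u ≗ advance o v
      advance-cong pop         eq i             = eq (suc i)
      advance-cong (replace a) eq zero          = refl
      advance-cong (replace a) eq (suc i)       = eq (suc i)
      advance-cong (push a b)  eq zero          = refl
      advance-cong (push a b)  eq (suc zero)    = refl
      advance-cong (push a b)  eq (suc (suc i)) = eq (suc i)

      evolve-cong : ∀ {c d} → c ≈ d → evolve c ≈ evolve d
      evolve-cong {c} {d} eq i j rewrite Vec.tabulate-cong (eq 0) =
        advance-cong (operation (tabulate (d 0)) j) (λ i → eq i j) i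

      module _ (c : Config M) where

        private
          κ : Track → Bool
          κ = readTracks (tabulate (stacks c 0))

        readTracks-stacks : ∀ r → κ r ≡ trackBit c r 0
        readTracks-stacks r = trans (Vec.lookup∘tabulate (stacks c 0) (index Track-finite r))
          (cong (λ r → trackBit c r 0) (element-index Track-finite r))

        topState-stacks : topState κ ≡ Config.state c
        topState-stacks = decodeState-stateBits (Config.state c) (readTracks-stacks ∘ inj₁)

        topSymbol-stacks : ∀ d t → topSymbol κ d t ≡ symbolAt (side d (lookup (Config.contents c) t)) 0
        topSymbol-stacks d t = decodeSymbol-symbolBits _ (λ w → readTracks-stacks (inj₂ (t , d , w)))

        topSymbols-stacks : tabulate (topSymbol κ true) ≡ Vec.map Tape.head (Config.contents c)
        topSymbols-stacks = trans
          (Vec.tabulate-cong λ t → trans (topSymbol-stacks true t) (sym (Vec.lookup-map t Tape.head (Config.contents c))))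
          (Vec.tabulate∘lookup _)

        evolve-stacks : evolve (stacks c) ≈ stacks (stepOrStay c)
        evolve-stacks i j rewrite topState-stacks | topSymbols-stacks
          with δ (Config.state c) (Vec.map Tape.head (Config.contents c))
        ... | nothing = halted i (element Track-finite j)
          where
          halted : ∀ i r → advance (replace (κ r)) (trackBit c r) i ≡ trackBit c r i
          halted zero    r = readTracks-stacks r
          halted (suc i) r = refl
        ... | just (q , as) = moved i (element Track-finite j)
          where
          moved : ∀ i r → advance (trackOperation κ (just (q , as)) r) (trackBit c r) i ≡
                  trackBit (config q (Vec.zipWith (act M) as (Config.contents c))) r i
          moved zero    (inj₁ r) = refl
          moved (suc i) (inj₁ r) = refl
          moved i (inj₂ (t , d , w)) rewrite topSymbol-stacks false t = trans
            (side-moves d (proj₂ (lookup as t)) (proj₁ (lookup as t)) (lookup (Config.contents c) t) w i)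
            (cong (λ t → symbolBits (symbolAt (side d t) i) w) (sym (Vec.lookup-zipWith (act M) t as (Config.contents c))))

      load-stacks : ∀ x → load x ≈ stacks (initial M x)
      load-stacks x i j = loaded (element Track-finite j) i
        where
        never : ∀ i → symbolAt (blank ∷ []) i ≡ blank
        never zero    = refl
        never (suc i) = refl
        input : ∀ x i → maybe′ bit blank (nth x i) ≡ symbolAt (side true (initialTape x)) i
        input []      i       = sym (never i)
        input (b ∷ x) zero    = refl
        input (b ∷ x) (suc i) = rest x i
          where
          rest : ∀ x i → maybe′ bit blank (nth x i) ≡ symbolAt (List.map bit x) i
          rest []      i       = refl
          rest (b ∷ x) zero    = refl
          rest (b ∷ x) (suc i) = rest x i
        noLeft : ∀ x → side false (initialTape x) ≡ []
        noLeft []      = refl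
        noLeft (_ ∷ _) = refl
        loaded : ∀ r i → trackColour (nth x i) r ≡ trackBit (initial M x) r i
        loaded (inj₁ r) zero rewrite dec-true (start Fin.≟ start) refl = refl
        loaded (inj₁ r) (suc i) = refl
        loaded (inj₂ (zero , true , w)) i = cong (λ a → symbolBits a w) (input x i)
        loaded (inj₂ (zero , false , w)) i rewrite noLeft x = refl
        loaded (inj₂ (suc t , true , w)) i rewrite Vec.lookup-replicate t (initialTape {auxSymbols} []) | never i = refl
        loaded (inj₂ (suc t , false , w)) i rewrite Vec.lookup-replicate t (initialTape {auxSymbols} []) = refl

      module _ {x : List Bool} (h : Halting M x) (space≤ : Halting.space h ≤ ⟦ p ⟧ (length x)) where

        private
          run : ℕ → Stacks
          run t = iter t evolve (load x)

        run-stacks : ∀ t → run t ≈ stacks (configAt h t)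
        run-stacks zero    = load-stacks x
        run-stacks (suc t) i j = trans (evolve-cong (run-stacks t) i j) (evolve-stacks (configAt h t) i j)

        run-small : ∀ t {i} j → s x ≤ i → run t i j ≡ false
        run-small t {i} j s≤i = trans (run-stacks t i j)
          (trackBit-beyond (configAt h t) (element Track-finite j)
            (≤-trans (space-configAt h t) (≤-trans space≤ (≤-trans (m≤n+m _ (length x)) s≤i))))

        -- The rows from s on are `false` throughout the run, so the s · D bits above them determine
        -- a configuration.
        label : ℕ → Fin (2 ^ (s x * D))
        label t = Fin.funToFin (λ q → let i , j = Fin.remQuot {s x} D q in Inverse.from 2↔Bool (run t (toℕ i) j))

        label-injective : ∀ {t u} → label t ≡ label u → run t ≈ run u
        label-injective {t} {u} eq i j with i <? s x
        ... | no  i≮s = trans (run-small t j (≮⇒≥ i≮s)) (sym (run-small u j (≮⇒≥ i≮s)))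
        ... | yes i<s = subst (λ i → run t i j ≡ run u i j) (toℕ-fromℕ< i<s)
          (bit-injective (trans (bit-label t) (trans (cong (λ l → Fin.finToFun l q) eq) (sym (bit-label u)))))
          where
          k : Fin (s x)
          k = Fin.fromℕ< i<s
          q : Fin (s x * D)
          q = Fin.combine k j
          bit-label : ∀ t → Inverse.from 2↔Bool (run t (toℕ k) j) ≡ Fin.finToFun {2} {s x * D} (label t) q
          bit-label t = sym (trans (finToFun-funToFin _ q)
            (cong (λ (i , j) → Inverse.from 2↔Bool (run t (toℕ i) j)) (remQuot-combine k j)))
          bit-injective : ∀ {a b} → Inverse.from 2↔Bool a ≡ Inverse.from 2↔Bool b → a ≡ b
          bit-injective {a} {b} eq = trans (sym (Inverse.strictlyInverseˡ 2↔Bool a))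
            (trans (cong (Inverse.to 2↔Bool) eq) (Inverse.strictlyInverseˡ 2↔Bool b))

        -- The halting time may lie on either side of 2 ^ (s · D); the pigeonhole argument only
        -- needs the run to be stationary at that time.
        run-limit : run (2 ^ (s x * D)) ≈ stacks (Halting.final h)
        run-limit i j = trans
          (stationary-by _≈_ (λ _ _ → refl) (λ eq i j → sym (eq i j)) (λ eq eq′ i j → trans (eq i j) (eq′ i j))
            run evolve-cong label (λ {t} {u} → label-injective {t} {u}) {T} fixed i j)
          (trans (run-stacks T i j) (cong (λ c → stacks c i j) (configAt-final h)))
          where
          T = Halting.time h
          fixed : run (suc T) ≈ run T
          fixed i j = trans (run-stacks (suc T) i j)
            (trans (cong (λ c → stacks c i j) (trans (cong stepOrStay (configAt-final h))
                     (trans (halted-stays 1 (Halting.halted h)) (sym (configAt-final h)))))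
                   (sym (run-stacks T i j)))

        accept-answer : accept (tabulate (run (2 ^ (s x * D)) 0)) ≡ Halting.answer h
        accept-answer = trans (cong accept (Vec.tabulate-cong (run-limit 0)))
          (cong accepting (topState-stacks (Halting.final h)))

  𝔸-𝔹-PSPACE-hard : PSPACE-hard (PMC 𝔸 𝔹 𝔸⇛𝔹)
  𝔸-𝔹-PSPACE-hard L (M , p , decides) =
    reduction (λ x → instantiate x acceptance) (templateText acceptance) (λ x → instantiate-text x acceptance)
      (λ x l → let h , space≤ , accepts , _ = decides x in
        acceptance-intro x (run-small p h space≤) (trans (accept-answer p h space≤) (accepts l)))
      (λ x ¬l E t → let h , space≤ , _ , rejects = decides x in
        contradiction (trans (sym (rejects ¬l)) (trans (sym (accept-answer p h space≤))
          (acceptance-elim x (run-small p h space≤) t))) λ ())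
    where
    open Translation M
    open StackMachine p D operation accept colour
    open Templates p

corollary30 : Σ[ 𝔸⇛𝔹 ∈ 𝔸 ⇛ 𝔹 ] PSPACE-complete (PMC 𝔸 𝔹 𝔸⇛𝔹)
corollary30 = 𝔸⇛𝔹 , 𝔸-𝔹-PSPACE , Simulation.𝔸-𝔹-PSPACE-hard
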